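{- Let $G$ be a $k$-regular graph on $n$ vertices and let $\tau$ be the smallest eigenvalue of (the adjacency matrix of) $G$. For any subset $S$ of vertices of $G$, $$\mathscr{E}(S)\geq\frac{|S|^2}{2n}(k-\tau)+\frac{|S|\tau}{2},$$ where $\mathscr{E}(S)$ denotes the number of edges in the subgraph of $G$ induced by $S$.
   Context: Graphs are finite and simple. -}

module Defs where

open import Algebra.Bundles using (CommutativeMonoid)
open import Algebra.Bundles.Raw using (RawRing)
import Algebra.Definitions.RawMonoid as RawMonoidDefs
import Algebra.Properties.CommutativeSemigroup as CommutativeSemigroupProperties
open import Data.Bool.Base using (if_then_else_)
open import Data.Fin.Base using (Fin; _<_)
open import Data.Fin.Properties using (_<?_)
open import Data.Fin.Subset using (Subset; _∈_) renaming (∣_∣ to card)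
open import Data.Fin.Subset.Properties using (_∈?_)
import Data.Integer.Base as ℤ
open import Data.List.Base using (List; allFin; cartesianProduct; filter; length)
open import Data.Nat.Base as ℕ using (ℕ; _≥_; _⊔_)
import Data.Nat.Properties as ℕ
open import Data.Product.Base using (_×_; _,_; ∃-syntax; Σ-syntax)
open import Data.Rational.Base as ℚ using (ℚ; 0ℚ; 1ℚ; ½; ∣_∣)
import Data.Rational.Properties as ℚ
open import Data.Vec.Base using (tabulate)
open import Data.Vec.Functional using (Vector)
open import Level using (0ℓ)
open import Relation.Binary.Core using (Rel)
open import Relation.Binary.Definitions using (Decidable; Irreflexive; Symmetric)
open import Relation.Binary.PropositionalEquality
  using (_≡_; refl; sym; trans; cong; cong₂; subst; module ≡-Reasoning)
open import Relation.Nullary.Decidable using (does; _×-dec_)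
open import Relation.Nullary.Negation using (¬_)
open import Relation.Unary as Unary using (Pred)

------------------------------------------------------------------------
-- Real numbers: Cauchy sequences of rationals, equal when their
-- difference tends to zero.

Cauchy : (ℕ → ℚ) → Set
Cauchy x = ∀ ε → 0ℚ ℚ.< ε →
  ∃[ N ] (∀ m n → m ≥ N → n ≥ N → ∣ x m ℚ.- x n ∣ ℚ.≤ ε)

record ℝ : Set where
  constructor mkℝ
  field
    seq    : ℕ → ℚ
    cauchy : Cauchy seq
open ℝ public

infix 4 _≈ℝ_ _≤ℝ_

_≈ℝ_ : Rel ℝ 0ℓ
x ≈ℝ y = ∀ ε → 0ℚ ℚ.< ε →
  ∃[ N ] (∀ n → n ≥ N → ∣ seq x n ℚ.- seq y n ∣ ℚ.≤ ε)

-- The terms of x may exceed those of y, by an error that tends to zero: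
-- the order depends only on the limits.
_≤ℝ_ : Rel ℝ 0ℓ
x ≤ℝ y = ∀ ε → 0ℚ ℚ.< ε →
  ∃[ N ] (∀ n → n ≥ N → seq x n ℚ.≤ seq y n ℚ.+ ε)

module CauchyProperties where
  open CommutativeSemigroupProperties
    (CommutativeMonoid.commutativeSemigroup ℚ.+-0-commutativeMonoid)
    using (interchange)

  cancel : ∀ a b → (a ℚ.- b) ℚ.+ b ≡ a
  cancel a b = trans (ℚ.+-assoc a (ℚ.- b) b)
    (trans (cong (a ℚ.+_) (ℚ.+-inverseˡ b)) (ℚ.+-identityʳ a))

  sub-+ : ∀ a b c d → (a ℚ.+ b) ℚ.- (c ℚ.+ d) ≡ (a ℚ.- c) ℚ.+ (b ℚ.- d)
  sub-+ a b c d = trans (cong (a ℚ.+ b ℚ.+_) (ℚ.neg-distrib-+ c d))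
    (interchange a b (ℚ.- c) (ℚ.- d))

  sub-* : ∀ a b c d →
    a ℚ.* b ℚ.- c ℚ.* d ≡ a ℚ.* (b ℚ.- d) ℚ.+ (a ℚ.- c) ℚ.* d
  sub-* a b c d = begin
    a ℚ.* b ℚ.- c ℚ.* d
      ≡⟨ cong (ℚ._- c ℚ.* d) (cancel (a ℚ.* b) (a ℚ.* d)) ⟨
    ((a ℚ.* b ℚ.- a ℚ.* d) ℚ.+ a ℚ.* d) ℚ.- c ℚ.* d
      ≡⟨ ℚ.+-assoc (a ℚ.* b ℚ.- a ℚ.* d) (a ℚ.* d) (ℚ.- (c ℚ.* d)) ⟩
    (a ℚ.* b ℚ.- a ℚ.* d) ℚ.+ (a ℚ.* d ℚ.- c ℚ.* d)
      ≡⟨ cong₂ (λ p q → (a ℚ.* b ℚ.+ p) ℚ.+ (a ℚ.* d ℚ.+ q))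
           (ℚ.neg-distribʳ-* a d) (ℚ.neg-distribˡ-* c d) ⟩
    (a ℚ.* b ℚ.+ a ℚ.* (ℚ.- d)) ℚ.+ (a ℚ.* d ℚ.+ (ℚ.- c) ℚ.* d)
      ≡⟨ cong₂ ℚ._+_ (ℚ.*-distribˡ-+ a b (ℚ.- d)) (ℚ.*-distribʳ-+ d a (ℚ.- c)) ⟨
    a ℚ.* (b ℚ.- d) ℚ.+ (a ℚ.- c) ℚ.* d ∎
    where open ≡-Reasoning

  ½*pos : ∀ {ε} → 0ℚ ℚ.< ε → 0ℚ ℚ.< ½ ℚ.* ε
  ½*pos {ε} ε>0 = ℚ.positive⁻¹ _ {{ℚ.pos*pos⇒pos ½ ε {{ℚ.positive ε>0}}}}

  halves : ∀ ε → ½ ℚ.* ε ℚ.+ ½ ℚ.* ε ≡ ε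
  halves ε = trans (sym (ℚ.*-distribʳ-+ ε ½ ½)) (ℚ.*-identityˡ ε)

  module _ {A B : ℕ} where
    left : ∀ {m} → m ≥ A ⊔ B → m ≥ A
    left = ℕ.≤-trans (ℕ.m≤m⊔n A B)

    right : ∀ {m} → m ≥ A ⊔ B → m ≥ B
    right = ℕ.≤-trans (ℕ.m≤n⊔m A B)

  ∣∣-mono-* : ∀ p q r s → 0ℚ ℚ.≤ q → ∣ p ∣ ℚ.≤ q → ∣ r ∣ ℚ.≤ s →
    ∣ p ℚ.* r ∣ ℚ.≤ q ℚ.* s
  ∣∣-mono-* p q r s q≥0 p≤q r≤s = begin
    ∣ p ℚ.* r ∣        ≡⟨ ℚ.∣p*q∣≡∣p∣*∣q∣ p r ⟩
    ∣ p ∣ ℚ.* ∣ r ∣    ≤⟨ ℚ.*-monoʳ-≤-nonNeg ∣ r ∣ {{ℚ.nonNegative (ℚ.0≤∣p∣ r)}} p≤q ⟩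
    q ℚ.* ∣ r ∣        ≤⟨ ℚ.*-monoˡ-≤-nonNeg q {{ℚ.nonNegative q≥0}} r≤s ⟩
    q ℚ.* s            ∎
    where open ℚ.≤-Reasoning

  bounded : ∀ {x} → Cauchy x →
    ∃[ b ] (0ℚ ℚ.< b × ∃[ N ] (∀ n → n ≥ N → ∣ x n ∣ ℚ.≤ b))
  bounded {x} cx with N , h ← cx 1ℚ (ℚ.positive⁻¹ 1ℚ) =
    1ℚ ℚ.+ ∣ x N ∣ ,
    ℚ.positive⁻¹ _ {{ℚ.pos+nonNeg⇒pos 1ℚ ∣ x N ∣ {{ℚ.nonNegative (ℚ.0≤∣p∣ (x N))}}}} ,
    N , λ n n≥N → begin
      ∣ x n ∣                            ≡⟨ cong ∣_∣ (sym (cancel (x n) (x N))) ⟩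
      ∣ (x n ℚ.- x N) ℚ.+ x N ∣          ≤⟨ ℚ.∣p+q∣≤∣p∣+∣q∣ (x n ℚ.- x N) (x N) ⟩
      ∣ x n ℚ.- x N ∣ ℚ.+ ∣ x N ∣        ≤⟨ ℚ.+-monoˡ-≤ ∣ x N ∣ (h n N n≥N ℕ.≤-refl) ⟩
      1ℚ ℚ.+ ∣ x N ∣                     ∎
    where open ℚ.≤-Reasoning

  shrink : ∀ b → 0ℚ ℚ.< b → ∀ ε → 0ℚ ℚ.< ε → ∃[ δ ] (0ℚ ℚ.< δ × b ℚ.* δ ≡ ε)
  shrink b b>0 ε ε>0 = b⁻¹ ℚ.* ε , ℚ.positive⁻¹ _ {{ℚ.pos*pos⇒pos b⁻¹ {{ℚ.1/pos⇒pos b}} ε}} ,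
    trans (sym (ℚ.*-assoc b b⁻¹ ε))
      (trans (cong (ℚ._* ε) (ℚ.*-inverseʳ b)) (ℚ.*-identityˡ ε))
    where
    instance
      _ = ℚ.positive b>0
      _ = ℚ.positive ε>0
      _ = ℚ.pos⇒nonZero b
    b⁻¹ = ℚ.1/ b

  opaque
    cauchy-+ : ∀ {x y} → Cauchy x → Cauchy y → Cauchy (λ n → x n ℚ.+ y n)
    cauchy-+ {x} {y} cx cy ε ε>0
      with M , hx ← cx (½ ℚ.* ε) (½*pos ε>0)
         | N , hy ← cy (½ ℚ.* ε) (½*pos ε>0) =
      M ⊔ N , λ m n m≥ n≥ → begin
        ∣ (x m ℚ.+ y m) ℚ.- (x n ℚ.+ y n) ∣
          ≡⟨ cong ∣_∣ (sub-+ (x m) (y m) (x n) (y n)) ⟩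
        ∣ (x m ℚ.- x n) ℚ.+ (y m ℚ.- y n) ∣
          ≤⟨ ℚ.∣p+q∣≤∣p∣+∣q∣ (x m ℚ.- x n) (y m ℚ.- y n) ⟩
        ∣ x m ℚ.- x n ∣ ℚ.+ ∣ y m ℚ.- y n ∣
          ≤⟨ ℚ.+-mono-≤ (hx m n (left m≥) (left n≥)) (hy m n (right {M} m≥) (right {M} n≥)) ⟩
        ½ ℚ.* ε ℚ.+ ½ ℚ.* ε
          ≡⟨ halves ε ⟩
        ε ∎
      where open ℚ.≤-Reasoning

    cauchy-neg : ∀ {x} → Cauchy x → Cauchy (λ n → ℚ.- x n)
    cauchy-neg {x} cx ε ε>0 with N , h ← cx ε ε>0 = N , λ m n m≥ n≥ →
      subst (ℚ._≤ ε)
        (trans (sym (ℚ.∣-p∣≡∣p∣ (x m ℚ.- x n)))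
          (cong ∣_∣ (ℚ.neg-distrib-+ (x m) (ℚ.- x n))))
        (h m n m≥ n≥)

    cauchy-* : ∀ {x y} → Cauchy x → Cauchy y → Cauchy (λ n → x n ℚ.* y n)
    cauchy-* {x} {y} cx cy ε ε>0 =
      let a , a>0 , A , ha = bounded cx
          b , b>0 , B , hb = bounded cy
          δ , δ>0 , aδ = shrink a a>0 (½ ℚ.* ε) (½*pos ε>0)
          η , η>0 , bη = shrink b b>0 (½ ℚ.* ε) (½*pos ε>0)
          M , hx = cx η η>0
          N , hy = cy δ δ>0
      in
      (A ⊔ B) ⊔ (M ⊔ N) , λ m n m≥ n≥ → begin
        ∣ x m ℚ.* y m ℚ.- x n ℚ.* y n ∣
          ≡⟨ cong ∣_∣ (sub-* (x m) (y m) (x n) (y n)) ⟩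
        ∣ x m ℚ.* (y m ℚ.- y n) ℚ.+ (x m ℚ.- x n) ℚ.* y n ∣
          ≤⟨ ℚ.∣p+q∣≤∣p∣+∣q∣ (x m ℚ.* (y m ℚ.- y n)) ((x m ℚ.- x n) ℚ.* y n) ⟩
        ∣ x m ℚ.* (y m ℚ.- y n) ∣ ℚ.+ ∣ (x m ℚ.- x n) ℚ.* y n ∣
          ≤⟨ ℚ.+-mono-≤
               (∣∣-mono-* (x m) a (y m ℚ.- y n) δ (ℚ.<⇒≤ a>0)
                 (ha m (left {A} {B} (left {A ⊔ B} {M ⊔ N} m≥)))
                 (hy m n (right {M} {N} (right {A ⊔ B} {M ⊔ N} m≥)) (right {M} {N} (right {A ⊔ B} {M ⊔ N} n≥))))
               (∣∣-mono-* (x m ℚ.- x n) η (y n) b (ℚ.<⇒≤ η>0)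
                 (hx m n (left {M} {N} (right {A ⊔ B} {M ⊔ N} m≥)) (left {M} {N} (right {A ⊔ B} {M ⊔ N} n≥)))
                 (hb n (right {A} {B} (left {A ⊔ B} {M ⊔ N} n≥)))) ⟩
        a ℚ.* δ ℚ.+ η ℚ.* b
          ≡⟨ cong₂ ℚ._+_ aδ (trans (ℚ.*-comm η b) bη) ⟩
        ½ ℚ.* ε ℚ.+ ½ ℚ.* ε
          ≡⟨ halves ε ⟩
        ε ∎
      where open ℚ.≤-Reasoning

    cauchy-const : ∀ q → Cauchy (λ _ → q)
    cauchy-const q ε ε>0 = 0 , λ _ _ _ _ →
      subst (ℚ._≤ ε) (sym (cong ∣_∣ (ℚ.+-inverseʳ q))) (ℚ.<⇒≤ ε>0)

open CauchyProperties

fromℚ : ℚ → ℝ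
fromℚ q = mkℝ (λ _ → q) (cauchy-const q)

fromℕ : ℕ → ℝ
fromℕ n = fromℚ (ℤ.+ n ℚ./ 1)

0ℝ 1ℝ : ℝ
0ℝ = fromℚ 0ℚ
1ℝ = fromℚ 1ℚ

infix  8 -ℝ_
infixl 7 _*ℝ_
infixl 6 _+ℝ_ _-ℝ_

_+ℝ_ : ℝ → ℝ → ℝ
mkℝ x cx +ℝ mkℝ y cy = mkℝ (λ n → x n ℚ.+ y n) (cauchy-+ {x} {y} cx cy)

-ℝ_ : ℝ → ℝ
-ℝ mkℝ x cx = mkℝ (λ n → ℚ.- x n) (cauchy-neg {x} cx)

_-ℝ_ : ℝ → ℝ → ℝ
x -ℝ y = x +ℝ (-ℝ y)

_*ℝ_ : ℝ → ℝ → ℝ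
mkℝ x cx *ℝ mkℝ y cy = mkℝ (λ n → x n ℚ.* y n) (cauchy-* {x} {y} cx cy)

ℝ-rawRing : RawRing 0ℓ 0ℓ
ℝ-rawRing = record
  { Carrier = ℝ
  ; _≈_     = _≈ℝ_
  ; _+_     = _+ℝ_
  ; _*_     = _*ℝ_
  ; -_      = -ℝ_
  ; 0#      = 0ℝ
  ; 1#      = 1ℝ
  }

open RawMonoidDefs (RawRing.+-rawMonoid ℝ-rawRing) public
  using () renaming (sum to sumℝ)

------------------------------------------------------------------------
-- Real matrices and eigenvalues

Matrix : ℕ → Set
Matrix n = Fin n → Fin n → ℝ

IsEigenvalue : ∀ {n} → Matrix n → ℝ → Set
IsEigenvalue {n} A μ = Σ[ v ∈ Vector ℝ n ]
  (¬ (∀ i → v i ≈ℝ 0ℝ) ×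
   (∀ i → sumℝ (λ j → A i j *ℝ v j) ≈ℝ μ *ℝ v i))

IsSmallestEigenvalue : ∀ {n} → Matrix n → ℝ → Set
IsSmallestEigenvalue A τ =
  IsEigenvalue A τ × (∀ μ → IsEigenvalue A μ → τ ≤ℝ μ)

------------------------------------------------------------------------
-- Finite simple graphs

record Graph (n : ℕ) : Set₁ where
  infix 4 _~_ _~?_
  field
    _~_      : Rel (Fin n) 0ℓ
    ~-sym    : Symmetric _~_
    ~-irrefl : Irreflexive _≡_ _~_
    _~?_     : Decidable _~_

module _ {n : ℕ} (G : Graph n) where
  open Graph G

  neighbours : Fin n → Subset n
  neighbours i = tabulate (λ j → does (i ~? j))

  Regular : ℕ → Set
  Regular k = ∀ i → card (neighbours i) ≡ k

  adjacencyMatrix : Matrix n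
  adjacencyMatrix i j = if does (i ~? j) then 1ℝ else 0ℝ

  -- Each edge is listed once, with its smaller endpoint first.
  IsEdge : Pred (Fin n × Fin n) 0ℓ
  IsEdge (i , j) = i < j × i ~ j

  isEdge? : Unary.Decidable IsEdge
  isEdge? (i , j) = (i <? j) ×-dec (i ~? j)

  edges : List (Fin n × Fin n)
  edges = filter isEdge? (cartesianProduct (allFin n) (allFin n))

  BothIn : Subset n → Pred (Fin n × Fin n) 0ℓ
  BothIn S (i , j) = i ∈ S × j ∈ S

  bothIn? : ∀ S → Unary.Decidable (BothIn S)
  bothIn? S (i , j) = (i ∈? S) ×-dec (j ∈? S)

  inducedEdges : Subset n → List (Fin n × Fin n)
  inducedEdges S = filter (bothIn? S) edges

  ℰ : Subset n → ℕ
  ℰ S = length (inducedEdges S)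

-- Let x = n 1_S − |S| 1.  Since 1 is an eigenvector for k, xᵀAx is
-- 2 n² ℰ(S) − n k |S|², and |x|² = n² |S| − n |S|², so the bound is the Rayleigh
-- inequality xᵀAx ≥ τ |x|² divided by 2 n².
--
-- The Rayleigh inequality is obtained from τ being the least eigenvalue by
-- exhibiting an eigenvalue μ with xᵀAx ≥ μ |x|².  Positive definiteness of the
-- rational matrices A − q I is decidable by elimination, so bisection yields
-- μ = sup {q : A − q I positive definite} as a Cauchy sequence.  The order on the
-- reals is stable under double negation, so it is enough that A − μ I is not
-- without kernel vectors.  Elimination, with case distinctions on the signs of
-- the pivots under double negation, otherwise finds a negative direction, which
-- contradicts the terms of μ being lower bounds, or makes the form coercive,
-- which contradicts its taking values at most ε |w|² at some w ≠ 0 for each ε > 0.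
-- Schur complements are scaled by the pivot, so no inverses of reals are needed.

module Submission where

open import Defs
open import Algebra.Bundles using (CommutativeRing)
import Algebra.Properties.Ring as RingProperties
import Algebra.Properties.Semiring.Sum as SemiringSum
import Algebra.Solver.Ring as RingSolver
open import Algebra.Solver.Ring.AlmostCommutativeRing
  using (_-Raw-AlmostCommutative⟶_; fromCommutativeRing)
open import Algebra.Structures using (IsCommutativeRing)
open import Data.Bool.Base using (Bool; true; false; if_then_else_; _∧_)
open import Data.Fin.Base using (Fin; zero; suc)
open import Data.Fin.Properties using (_<?_; <-cmp)
open import Data.Fin.Subset using (Subset; inside; outside; ∣_∣)
open import Data.Fin.Subset.Properties using (_∈?_)
import Data.Integer.Base as ℤ
import Data.Integer.Properties as ℤ
open import Data.List.Base as List using (List; []; _∷_; allFin; cartesianProduct; filter; length)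
open import Data.Maybe.Base as Maybe using (Maybe)
open import Data.Nat.Base as ℕ using (ℕ; zero; suc; NonZero; _≥_; _⊔_)
open import Data.Nat.Coprimality using (1-coprimeTo) renaming (sym to coprime-sym)
import Data.Nat.Properties as ℕ
open import Data.Product.Base using (_×_; _,_; ∃-syntax; proj₁; proj₂)
open import Data.Rational.Base as ℚ using (ℚ; mkℚ; 0ℚ; 1ℚ; ½)
import Data.Rational.Properties as ℚ
open import Data.Rational.Solver using (module +-*-Solver)
import Data.Rational.Unnormalised.Base as ℚᵘ
import Data.Rational.Unnormalised.Properties as ℚᵘ
open import Data.Sum.Base using (inj₁; inj₂)
open import Data.Unit.Base using (⊤; tt)
open import Data.Vec.Base as Vec using ([]; _∷_)
open import Data.Vec.Functional as Vector using (Vector; tail; replicate)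
open import Function.Base using (_∘_; id)
open import Level using (0ℓ)
open import Relation.Binary.Definitions using (WeaklyDecidable; tri<; tri≈; tri>)
import Relation.Binary.PropositionalEquality as ≡
import Relation.Binary.Reasoning.Setoid as SetoidReasoning
open import Relation.Binary.Structures using (IsEquivalence)
open import Relation.Nullary.Decidable
  using (Dec; yes; no; does; _×-dec_; dec⇒maybe; dec-true; dec-false; decidable-stable)
open import Relation.Nullary.Negation using (¬_; contradiction)
open import Relation.Unary using (Pred; Decidable)
open CauchyProperties hiding (cancel)

-- Quadratic forms over ordered commutative rings

-- Positivity is the primitive notion because on the reals no sign can be decided. `tight` is the
-- remnant of trichotomy that the rationals and the reals share.
record OrderedAlgebra : Set₁ where
  field
    commutativeRing : CommutativeRing 0ℓ 0ℓ
  open CommutativeRing commutativeRing public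
  field
    -- Coefficients with decidable equality, for the ring solver.
    scalars  : ℚ.+-*-rawRing -Raw-AlmostCommutative⟶ fromCommutativeRing commutativeRing
    Pos      : Carrier → Set
    pos-resp : ∀ {x y} → x ≈ y → Pos x → Pos y
    pos-1    : Pos 1#
    ¬pos-0   : ¬ Pos 0#
    pos-+    : ∀ {x y} → Pos x → Pos y → Pos (x + y)
    pos-*    : ∀ {x y} → Pos x → Pos y → Pos (x * y)
    tight    : ∀ {x} → ¬ Pos x → ¬ Pos (- x) → x ≈ 0#

module OrderedAlgebraProperties (K : OrderedAlgebra) where
  open OrderedAlgebra K hiding (zero)
  open SemiringSum semiring public using (sum; sum-cong-≋; ∑-distrib-+; ∑-comm; *-distribˡ-sum)
  open RingProperties ring using (-0#≈0#; -‿distribˡ-*; -‿distribʳ-*)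
  open SetoidReasoning setoid
  open _-Raw-AlmostCommutative⟶_ scalars using (0-homo) renaming (⟦_⟧ to scalar)

  scalar-≟ : WeaklyDecidable (λ p q → scalar p ≈ scalar q)
  scalar-≟ p q = Maybe.map (λ p≡q → reflexive (≡.cong scalar p≡q)) (dec⇒maybe (p ℚ.≟ q))

  open RingSolver ℚ.+-*-rawRing (fromCommutativeRing commutativeRing) scalars scalar-≟
    using (solve; _:=_; _:+_; _:*_; :-_; _:-_; con; Polynomial)

  -- Being a negation, this is stable under double negation, so it may be proved by cases on signs
  -- that are not decidable.
  Nonneg : Carrier → Set
  Nonneg x = ¬ Pos (- x)

  module _ {x : Carrier} {b} {B : Set b} where
    -- Trichotomy, as it can be used to prove a negation.
    sign : (Pos x → ¬ B) → (x ≈ 0# → ¬ B) → (Pos (- x) → ¬ B) → ¬ B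
    sign p z n b = z (tight (λ h → p h b) (λ h → n h b)) b

  pos⇒nonneg : ∀ {x} → Pos x → Nonneg x
  pos⇒nonneg {x} px p-x = ¬pos-0 (pos-resp (-‿inverseʳ x) (pos-+ px p-x))

  nonneg-resp : ∀ {x y} → x ≈ y → Nonneg x → Nonneg y
  nonneg-resp x≈y nx p = nx (pos-resp (-‿cong (sym x≈y)) p)

  nonneg-0 : Nonneg 0#
  nonneg-0 p = ¬pos-0 (pos-resp -0#≈0# p)

  zero⇒nonneg : ∀ {x} → x ≈ 0# → Nonneg x
  zero⇒nonneg x≈0 = nonneg-resp (sym x≈0) nonneg-0

  nonneg-+ : ∀ {x y} → Nonneg x → Nonneg y → Nonneg (x + y)
  nonneg-+ {x} {y} nx ny = sign {x = x}
    (λ px p → ny (pos-resp (solve 2 (λ x y → :- (x :+ y) :+ x := :- y) refl x y) (pos-+ p px)))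
    (λ x≈0 p → ny (pos-resp (-‿cong (trans (+-congʳ x≈0) (+-identityˡ y))) p))
    (λ p-x _ → nx p-x)

  nonneg-* : ∀ {x y} → Nonneg x → Nonneg y → Nonneg (x * y)
  nonneg-* {x} {y} nx ny = sign {x = x}
    (λ px → sign {x = y}
      (λ py → pos⇒nonneg (pos-* px py))
      (λ y≈0 → zero⇒nonneg (trans (*-congˡ y≈0) (zeroʳ x)))
      (λ p-y _ → ny p-y))
    (λ x≈0 → zero⇒nonneg (trans (*-congʳ x≈0) (zeroˡ y)))
    (λ p-x _ → nx p-x)

  nonneg-square : ∀ x → Nonneg (x * x)
  nonneg-square x = sign {x = x}
    (λ px → pos⇒nonneg (pos-* px px))
    (λ x≈0 → zero⇒nonneg (trans (*-congʳ x≈0) (zeroˡ x)))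
    (λ p-x → pos⇒nonneg (pos-resp (solve 1 (λ x → :- x :* :- x := x :* x) refl x) (pos-* p-x p-x)))

  nonneg-cancel : ∀ {a x} → Pos a → Nonneg (a * x) → Nonneg x
  nonneg-cancel {a} {x} pa nax p-x =
    nax (pos-resp (sym (-‿distribʳ-* a x)) (pos-* pa p-x))

  ¬¬pos-cancel : ∀ {a x} → Pos a → Pos (a * x) → ¬ ¬ Pos x
  ¬¬pos-cancel {a} {x} pa pax ¬px = sign {x = x}
    (λ px _ → ¬px px)
    (λ x≈0 p → ¬pos-0 (pos-resp (trans (*-congˡ x≈0) (zeroʳ a)) p))
    (λ p-x p → pos⇒nonneg p (pos-resp (sym (-‿distribʳ-* a x)) (pos-* pa p-x)))
    pax

  ¬¬pos-+-nonneg : ∀ {x y} → Pos x → Nonneg y → ¬ ¬ Pos (x + y)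
  ¬¬pos-+-nonneg {x} {y} px ny = sign {x = y}
    (λ py k → k (pos-+ px py))
    (λ y≈0 k → k (pos-resp (sym (trans (+-congˡ y≈0) (+-identityʳ x))) px))
    (λ p-y _ → ny p-y)

  cancel-zero : ∀ {a x} → Pos a → a * x ≈ 0# → x ≈ 0#
  cancel-zero {a} {x} pa ax≈0 = tight
    (λ px → ¬pos-0 (pos-resp ax≈0 (pos-* pa px)))
    (λ p-x → ¬pos-0 (pos-resp
      (trans (sym (-‿distribʳ-* a x)) (trans (-‿cong ax≈0) -0#≈0#)) (pos-* pa p-x)))

  square-zero : ∀ {x} → x * x ≈ 0# → x ≈ 0#
  square-zero {x} xx≈0 = tight
    (λ px → ¬pos-0 (pos-resp xx≈0 (pos-* px px)))
    (λ p-x → ¬pos-0 (pos-resp xx≈0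
      (pos-resp (solve 1 (λ x → :- x :* :- x := x :* x) refl x) (pos-* p-x p-x))))

  summand-zero : ∀ {x y} → Nonneg x → Nonneg y → x + y ≈ 0# → x ≈ 0#
  summand-zero nx ny x+y≈0 = tight
    (λ px → ¬¬pos-+-nonneg px ny (λ p → ¬pos-0 (pos-resp x+y≈0 p)))
    nx

  -- Vectors and the inner product

  infix 9 _·_

  _·_ : ∀ {n} → Vector Carrier n → Vector Carrier n → Carrier
  u · v = sum (λ i → u i * v i)

  ·-cong : ∀ {n} {u u′ v v′ : Vector Carrier n} →
    (∀ i → u i ≈ u′ i) → (∀ i → v i ≈ v′ i) → u · v ≈ u′ · v′
  ·-cong u≈ v≈ = sum-cong-≋ (λ i → *-cong (u≈ i) (v≈ i))

  ·-comm : ∀ {n} (u v : Vector Carrier n) → u · v ≈ v · u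
  ·-comm u v = sum-cong-≋ (λ i → *-comm (u i) (v i))

  ·-linearʳ : ∀ {n} (u v w : Vector Carrier n) p q →
    u · (λ i → p * v i + q * w i) ≈ p * u · v + q * u · w
  ·-linearʳ {zero} u v w p q =
    sym (trans (+-cong (zeroʳ p) (zeroʳ q)) (+-identityˡ 0#))
  ·-linearʳ {suc n} u v w p q =
    trans (+-congˡ (·-linearʳ (tail u) (tail v) (tail w) p q))
      (solve 7 (λ u v w p q s t →
        u :* (p :* v :+ q :* w) :+ (p :* s :+ q :* t)
          := p :* (u :* v :+ s) :+ q :* (u :* w :+ t))
        refl (u zero) (v zero) (w zero) p q (tail u · tail v) (tail u · tail w))

  ·-linearˡ : ∀ {n} (u v w : Vector Carrier n) p q →
    (λ i → p * u i + q * v i) · w ≈ p * u · w + q * v · w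
  ·-linearˡ u v w p q = trans (·-comm _ w) (trans (·-linearʳ w u v p q)
    (+-cong (*-congˡ (·-comm w u)) (*-congˡ (·-comm w v))))

  ·-scaleʳ : ∀ {n} (u v : Vector Carrier n) p → u · (λ i → p * v i) ≈ p * u · v
  ·-scaleʳ {zero} u v p = sym (zeroʳ p)
  ·-scaleʳ {suc n} u v p = trans (+-congˡ (·-scaleʳ (tail u) (tail v) p))
    (solve 4 (λ u v p s → u :* (p :* v) :+ p :* s := p :* (u :* v :+ s))
      refl (u zero) (v zero) p (tail u · tail v))

  ·-zeroʳ : ∀ {n} (u : Vector Carrier n) → u · replicate n 0# ≈ 0#
  ·-zeroʳ {zero} u = refl
  ·-zeroʳ {suc n} u = trans (+-cong (zeroʳ (u zero)) (·-zeroʳ (tail u))) (+-identityˡ 0#)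

  nonneg-norm : ∀ {n} (v : Vector Carrier n) → Nonneg (v · v)
  nonneg-norm {zero} v = nonneg-0
  nonneg-norm {suc n} v = nonneg-+ (nonneg-square (v zero)) (nonneg-norm (tail v))

  norm-zero : ∀ {n} (v : Vector Carrier n) → v · v ≈ 0# → ∀ i → v i ≈ 0#
  norm-zero v vv≈0 zero =
    square-zero (summand-zero (nonneg-square (v zero)) (nonneg-norm (tail v)) vv≈0)
  norm-zero v vv≈0 (suc i) = norm-zero (tail v)
    (summand-zero (nonneg-norm (tail v)) (nonneg-square (v zero)) (trans (+-comm _ _) vv≈0)) i

  -- A Cauchy–Schwarz inequality without the sharp constant |b|².
  ·-bound : ∀ {n} (b : Vector Carrier n) →
    ∃[ B ] (Nonneg B × ∀ y → Nonneg (B * y · y - b · y * b · y))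
  ·-bound {zero} b = 0# , nonneg-0 , λ y → zero⇒nonneg
    (trans (+-cong (zeroˡ 0#) (trans (-‿cong (zeroˡ 0#)) -0#≈0#)) (+-identityˡ 0#))
  ·-bound {suc n} b with B , nB , h ← ·-bound (tail b) =
    -- The doubling comes from (p + q)² ≤ 2 p² + 2 q², whose slack is (p - q)². The mixed terms b₀²
    -- |y′|² and B y₀², with y′ the tail of y, are nonnegative.
    b₀² + b₀² + (B + B) ,
    nonneg-+ (nonneg-+ nb₀² nb₀²) (nonneg-+ nB nB) ,
    λ y → let
        y₀ = y zero
        s = tail y · tail y
        r = tail b · tail y
        nBy₀² = nonneg-* nB (nonneg-square y₀)
        nb₀²s = nonneg-* nb₀² (nonneg-norm (tail y))
      in nonneg-resp
        (solve 5 (λ b y B s r →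
          ((b :* y :- r) :* (b :* y :- r) :+ ((B :* s :- r :* r) :+ (B :* s :- r :* r)))
            :+ ((b :* b :* s :+ b :* b :* s) :+ (B :* (y :* y) :+ B :* (y :* y)))
          := (b :* b :+ b :* b :+ (B :+ B)) :* (y :* y :+ s)
            :- (b :* y :+ r) :* (b :* y :+ r))
          refl (b zero) y₀ B s r)
        (nonneg-+ (nonneg-+ (nonneg-square _) (nonneg-+ (h (tail y)) (h (tail y))))
          (nonneg-+ (nonneg-+ nb₀²s nb₀²s) (nonneg-+ nBy₀² nBy₀²)))
    where
    b₀² = b zero * b zero
    nb₀² = nonneg-square (b zero)

  -- Symmetric matrices, Schur complements and coercivity

  SquareMatrix : ℕ → Set
  SquareMatrix n = Fin n → Fin n → Carrier

  Symmetric : ∀ {n} → SquareMatrix n → Set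
  Symmetric M = ∀ i j → M i j ≈ M j i

  form : ∀ {n} → SquareMatrix n → Vector Carrier n → Carrier
  form M v = v · (λ i → M i · v)

  form-scale : ∀ {n} (M : SquareMatrix n) c v → form M (λ i → c * v i) ≈ c * c * form M v
  form-scale M c v = begin
    cv · (λ i → M i · cv)         ≈⟨ ·-cong (λ _ → refl) (λ i → ·-scaleʳ (M i) v c) ⟩
    cv · (λ i → c * M i · v)      ≈⟨ ·-scaleʳ cv (λ i → M i · v) c ⟩
    c * cv · (λ i → M i · v)      ≈⟨ *-congˡ (·-comm cv _) ⟩
    c * (λ i → M i · v) · cv      ≈⟨ *-congˡ (·-scaleʳ _ v c) ⟩
    c * (c * (λ i → M i · v) · v) ≈⟨ *-assoc c c _ ⟨
    c * c * (λ i → M i · v) · v   ≈⟨ *-congˡ (·-comm _ v) ⟩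
    c * c * form M v              ∎
    where cv = λ i → c * v i

  module _ {n} (M : SquareMatrix (suc n)) where
    corner : Carrier
    corner = M zero zero

    border : Vector Carrier n
    border j = M zero (suc j)

    minor : SquareMatrix n
    minor i j = M (suc i) (suc j)

    -- The Schur complement, multiplied by the corner entry to avoid a division.
    schur : SquareMatrix n
    schur i j = corner * minor i j + (- border i) * border j

  schur-· : ∀ {n} (M : SquareMatrix (suc n)) y i →
    schur M i · y ≈ corner M * minor M i · y + (- border M i) * border M · y
  schur-· M y i = ·-linearˡ (minor M i) (border M) y (corner M) (- border M i)

  form-schur : ∀ {n} (M : SquareMatrix (suc n)) y →
    form (schur M) y ≈ corner M * form (minor M) y - border M · y * border M · y
  form-schur M y = begin
    y · (λ i → schur M i · y)
      ≈⟨ ·-cong (λ _ → refl) (λ i → trans (schur-· M y i) (+-congˡ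
           (solve 2 (λ b s → :- b :* s := :- s :* b) refl (border M i) (border M · y)))) ⟩
    y · (λ i → corner M * minor M i · y + (- border M · y) * border M i)
      ≈⟨ ·-linearʳ y (λ i → minor M i · y) (border M) (corner M) (- border M · y) ⟩
    corner M * form (minor M) y + (- border M · y) * y · border M
      ≈⟨ +-congˡ (trans (*-congˡ (·-comm y (border M))) (sym (-‿distribˡ-* _ _))) ⟩
    corner M * form (minor M) y - border M · y * border M · y ∎

  module _ {n} (M : SquareMatrix (suc n)) (M-sym : Symmetric M) where
    private
      a = corner M
      b = border M

    schur-symmetric : Symmetric (schur M)
    schur-symmetric i j = +-cong (*-congˡ (M-sym (suc i) (suc j)))
      (solve 2 (λ p q → :- p :* q := :- q :* p) refl (b i) (b j))

    form-split : ∀ v → let x = v zero; y = tail v in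
      form M v ≈ x * (a * x + b · y) + (x * b · y + form (minor M) y)
    form-split v = +-congˡ (begin
      y · (λ i → M (suc i) zero * x + minor M i · y)
        ≈⟨ ·-cong (λ _ → refl) (λ i → +-cong
             (trans (*-congʳ (M-sym (suc i) zero)) (*-comm _ x)) (sym (*-identityˡ _))) ⟩
      y · (λ i → x * b i + 1# * minor M i · y)
        ≈⟨ ·-linearʳ y b (λ i → minor M i · y) x 1# ⟩
      x * y · b + 1# * form (minor M) y
        ≈⟨ +-cong (*-congˡ (·-comm y b)) (*-identityˡ _) ⟩
      x * b · y + form (minor M) y ∎)
      where
      x = v zero
      y = tail v

    -- Completing the square in the first coordinate: u² absorbs every term that involves x, and the
    -- Schur complement is what is left in y. Multiplying by a keeps the identity free of division.
    complete-square : ∀ v → let u = a * v zero + b · tail v in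
      a * form M v ≈ u * u + form (schur M) (tail v)
    complete-square v = begin
      a * form M v
        ≈⟨ *-congˡ (form-split v) ⟩
      a * (x * (a * x + β) + (x * β + q))
        ≈⟨ solve 4 (λ a x β q →
             a :* (x :* (a :* x :+ β) :+ (x :* β :+ q))
               := (a :* x :+ β) :* (a :* x :+ β) :+ (a :* q :- β :* β))
             refl a x β q ⟩
      (a * x + β) * (a * x + β) + (a * q - β * β)
        ≈⟨ +-congˡ (form-schur M (tail v)) ⟨
      (a * x + β) * (a * x + β) + form (schur M) (tail v) ∎
      where
      x = v zero
      β = b · tail v
      q = form (minor M) (tail v)

  -- Positivity of the successive scaled pivots rather than of the values of the form: a finite
  -- conjunction of sign conditions, hence decidable over the rationals.
  PosDef : ∀ {n} → SquareMatrix n → Set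
  PosDef {zero}  M = ⊤
  PosDef {suc n} M = Pos (corner M) × PosDef (schur M)

  form-nonneg : ∀ {n} (M : SquareMatrix n) → Symmetric M → PosDef M →
    ∀ v → Nonneg (form M v)
  form-nonneg {zero}  M M-sym _ v = nonneg-0
  form-nonneg {suc n} M M-sym (pa , pd) v = nonneg-cancel pa (nonneg-resp
    (sym (complete-square M M-sym v))
    (nonneg-+ (nonneg-square _)
      (form-nonneg (schur M) (schur-symmetric M M-sym) pd (tail v))))

  -- The constant of coercivity is e/D, kept as a numerator and a denominator to avoid division.
  Coercive : ∀ {n} → SquareMatrix n → Set
  Coercive M = ∃[ e ] ∃[ D ] (Pos e × Pos D × ∀ v → Nonneg (D * form M v - e * v · v))

  -- With u = a x + b·y and (b·y)² ≤ B |y|², the Schur complement bound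
  -- e |y|² ≤ D S(y) and a² x² ≤ 2 u² + 2 B |y|² combine, after multiplication
  -- by m = 2 e + 2 D B + D a², to D e a² |v|² ≤ m D (u² + S(y)) = m D a M(v).
  posDef⇒coercive : ∀ {n} (M : SquareMatrix n) → Symmetric M → PosDef M → ¬ ¬ Coercive M
  posDef⇒coercive {zero} M _ _ k = k (1# , 1# , pos-1 , pos-1 , λ v →
    zero⇒nonneg (-‿inverseʳ (1# * 0#)))
  posDef⇒coercive {suc n} M M-sym (pa , pd) k =
    posDef⇒coercive (schur M) (schur-symmetric M M-sym) pd
      λ (e , D , pe , pD , h) → let
        B , nB , hB = ·-bound (border M)
        a = corner M
        pe₂ = pos-+ pe pe
        nDB = nonneg-* (pos⇒nonneg pD) nB
        pDa² = pos-* pD (pos-* pa pa)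
        m = (e + e + D * (a * a)) + (D * B + D * B)
      in ¬¬pos-+-nonneg (pos-+ pe₂ pDa²) (nonneg-+ nDB nDB) λ pm →
      k (D * e * (a * a) , m * D * a ,
         pos-* (pos-* pD pe) (pos-* pa pa) , pos-* (pos-* pm pD) pa , λ v → let
           x = v zero
           y = tail v
           s = y · y
           β = border M · y
           u = a * x + β
           q = form (schur M) y
           ne = pos⇒nonneg pe
           nD = pos⇒nonneg pD
           nDe = nonneg-* nD ne
           nes = nonneg-* ne (nonneg-norm y)
           nDBD = nonneg-* (nonneg-+ nDB nDB) nD
           nu = nonneg-* (nonneg-+ (nonneg-* (pos⇒nonneg pDa²) nD) nDBD) (nonneg-square u)
           nw = nonneg-* nDe (nonneg-square (u + β))
           nz = nonneg-* nDe (hB y)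
         in nonneg-resp
           (begin
             (m * (D * q - e * s) + (D * (a * a) * D + (D * B + D * B) * D) * (u * u))
               + ((D * e * ((u + β) * (u + β)) + e * (e * s + e * s))
                 + (D * e * (B * s - β * β) + D * e * (B * s - β * β)))
               ≈⟨ solve 8 (λ a x β e D B s q → let
                      u = a :* x :+ β
                      m = (e :+ e :+ D :* (a :* a)) :+ (D :* B :+ D :* B)
                    in
                    (m :* (D :* q :- e :* s)
                        :+ (D :* (a :* a) :* D :+ (D :* B :+ D :* B) :* D) :* (u :* u))
                      :+ ((D :* e :* ((u :+ β) :* (u :+ β)) :+ e :* (e :* s :+ e :* s))
                        :+ (D :* e :* (B :* s :- β :* β) :+ D :* e :* (B :* s :- β :* β)))
                    := m :* D :* (u :* u :+ q) :- D :* e :* (a :* a) :* (x :* x :+ s))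
                  refl a x β e D B s q ⟩
             m * D * (u * u + q) - D * e * (a * a) * (x * x + s)
               ≈⟨ +-congʳ (trans (*-assoc _ _ _) (*-congˡ (complete-square M M-sym v))) ⟨
             m * D * a * form M v - D * e * (a * a) * v · v ∎)
           (nonneg-+ (nonneg-+ (nonneg-* (pos⇒nonneg pm) (h y)) nu)
             (nonneg-+ (nonneg-+ nw (nonneg-* ne (nonneg-+ nes nes))) (nonneg-+ nz nz))))

  -- Elimination: kernel vectors and negative directions

  Kernel : ∀ {n} → SquareMatrix n → Set
  Kernel M = ∃[ v ] (¬ (∀ i → v i ≈ 0#) × ∀ i → M i · v ≈ 0#)

  Negative : ∀ {n} → SquareMatrix n → Set
  Negative M = ∃[ v ] Pos (- form M v)

  1≉0 : ¬ 1# ≈ 0#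
  1≉0 1≈0 = ¬pos-0 (pos-resp 1≈0 pos-1)

  e₀ : ∀ {n} → Vector Carrier (suc n)
  e₀ {n} = 1# Vector.∷ replicate n 0#

  module _ {n} (M : SquareMatrix (suc n)) (M-sym : Symmetric M) where
    private
      a = corner M
      b = border M

    form-e₀ : form M e₀ ≈ a
    form-e₀ = begin
      form M e₀
        ≈⟨ form-split M M-sym e₀ ⟩
      1# * (a * 1# + b · 0s) + (1# * b · 0s + form (minor M) 0s)
        ≈⟨ +-cong (trans (*-identityˡ _) (trans (+-cong (*-identityʳ a) (·-zeroʳ b)) (+-identityʳ a)))
             (+-cong (trans (*-identityˡ _) (·-zeroʳ b))
               (trans (·-comm 0s (λ i → minor M i · 0s)) (·-zeroʳ (λ i → minor M i · 0s)))) ⟩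
      a + (0# + 0#)
        ≈⟨ trans (+-congˡ (+-identityˡ 0#)) (+-identityʳ a) ⟩
      a ∎
      where 0s = replicate n 0#

    kernel-e₀ : a ≈ 0# → (∀ i → b i ≈ 0#) → Kernel M
    kernel-e₀ a≈0 b≈0 = e₀ , (λ h → 1≉0 (h zero)) , λ where
        zero    → col (M zero) a≈0
        (suc i) → col (M (suc i)) (trans (M-sym (suc i) zero) (b≈0 i))
      where
      col : ∀ (r : Vector Carrier (suc n)) → r zero ≈ 0# → r · e₀ ≈ 0#
      col r r₀≈0 = trans (+-cong (trans (*-identityʳ _) r₀≈0) (·-zeroʳ (tail r))) (+-identityˡ 0#)

    -- The test vector (−(c + 1), 2 β b), with β = |b|² and c = b·C b, has
    -- form −4 β².
    negative-border : a ≈ 0# → Pos (b · b) → Negative M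
    negative-border a≈0 pβ = v , pos-resp (sym (begin
        - form M v
          ≈⟨ -‿cong (form-split M M-sym v) ⟩
        - (x * (a * x + b · y) + (x * b · y + form (minor M) y))
          ≈⟨ -‿cong (+-cong
               (*-congˡ (trans (+-cong (trans (*-congʳ a≈0) (zeroˡ x)) b·y) (+-identityˡ _)))
               (+-cong (*-congˡ b·y) (form-scale (minor M) (β + β) b))) ⟩
        - (x * ((β + β) * β) + (x * ((β + β) * β) + (β + β) * (β + β) * c))
          ≈⟨ -‿cong (+-cong xβ≈t (+-cong xβ≈t refl)) ⟩
        - (t + (t + (β + β) * (β + β) * c))
          ≈⟨ solve 2 (λ β c →
               let t = (:- c) :* ((β :+ β) :* β) :- (β :+ β) :* β
               in :- (t :+ (t :+ (β :+ β) :* (β :+ β) :* c)) := (β :+ β) :* (β :+ β))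
             refl β c ⟩
        (β + β) * (β + β) ∎))
      (pos-* (pos-+ pβ pβ) (pos-+ pβ pβ))
      where
      β = b · b
      c = form (minor M) b
      x = - (c + 1#)
      y = λ i → (β + β) * b i
      v = x Vector.∷ y
      t = (- c) * ((β + β) * β) - (β + β) * β
      b·y : b · y ≈ (β + β) * β
      b·y = ·-scaleʳ b b (β + β)
      xβ≈t : x * ((β + β) * β) ≈ t
      xβ≈t = trans
        (solve 3 (λ c β o → :- (c :+ o) :* ((β :+ β) :* β)
            := (:- c) :* ((β :+ β) :* β) :- o :* ((β :+ β) :* β))
          refl c β 1#)
        (+-congˡ (-‿cong (*-identityˡ _)))

    -- Back substitution, cleared of the denominator a: the vector (-b·y, a y) is annihilated by row
    -- zero, and the other rows send it to S y, with S the Schur complement.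
    kernel-schur : Pos a → Kernel (schur M) → Kernel M
    kernel-schur pa (y , y≉0 , Sy≈0) = v ,
      (λ v≈0 → y≉0 (λ i → cancel-zero pa (v≈0 (suc i)))) , λ where
        zero → trans (+-congˡ (·-scaleʳ b y a))
          (trans (solve 2 (λ a s → a :* (:- s) :+ a :* s := con 0ℚ) refl a (b · y)) 0-homo)
        (suc i) → begin
          M (suc i) zero * (- b · y) + minor M i · ay
            ≈⟨ +-cong (*-congʳ (M-sym (suc i) zero)) (·-scaleʳ (minor M i) y a) ⟩
          b i * (- b · y) + a * minor M i · y
            ≈⟨ solve 3 (λ b s t → b :* (:- s) :+ t := t :+ (:- b) :* s)
                 refl (b i) (b · y) (a * minor M i · y) ⟩
          a * minor M i · y + (- b i) * b · y
            ≈⟨ schur-· M y i ⟨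
          schur M i · y
            ≈⟨ Sy≈0 i ⟩
          0# ∎
      where
      ay = λ i → a * y i
      v = (- b · y) Vector.∷ ay

    -- The same back substitution makes the square in `complete-square` vanish, so that a M(v) = a²
    -- S(y). The factor a is then cancelled, which gives a sign only up to double negation.
    negative-schur : Pos a → Negative (schur M) → ¬ ¬ Negative M
    negative-schur pa (y , p) k = ¬¬pos-cancel pa (pos-resp (sym (begin
        a * (- form M v)
          ≈⟨ -‿distribʳ-* a _ ⟨
        - (a * form M v)
          ≈⟨ -‿cong (complete-square M M-sym v) ⟩
        - ((a * (- b · y) + b · ay) * (a * (- b · y) + b · ay) + form (schur M) ay)
          ≈⟨ -‿cong (+-cong (*-congˡ (+-congˡ (·-scaleʳ b y a))) (form-scale (schur M) a y)) ⟩
        - ((a * (- b · y) + b · ay) * (a * (- b · y) + a * b · y) + a * a * form (schur M) y)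
          ≈⟨ solve 4 (λ a s r q →
               :- ((a :* (:- s) :+ r) :* (a :* (:- s) :+ a :* s) :+ a :* a :* q)
                 := a :* a :* (:- q))
             refl a (b · y) (b · ay) (form (schur M) y) ⟩
        a * a * (- form (schur M) y) ∎)) (pos-* (pos-* pa pa) p))
      (λ p → k (v , p))
      where
      ay = λ i → a * y i
      v = (- b · y) Vector.∷ ay

  -- Symmetric Gaussian elimination; the signs of the pivots are only known
  -- up to double negation.
  ¬¬posDef : ∀ {n} (M : SquareMatrix n) → Symmetric M →
    ¬ Kernel M → ¬ Negative M → ¬ ¬ PosDef M
  ¬¬posDef {zero}  M _ _ _ k = k tt
  ¬¬posDef {suc n} M M-sym ¬ker ¬neg = sign {x = corner M}
    (λ pa k → ¬¬posDef (schur M) (schur-symmetric M M-sym)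
      (λ ker → ¬ker (kernel-schur M M-sym pa ker))
      (λ neg → negative-schur M M-sym pa neg ¬neg)
      (λ pd → k (pa , pd)))
    -- A zero pivot stops the elimination: a nonzero border yields a negative direction, and a zero
    -- border makes `e₀` a kernel vector.
    (λ a≈0 _ → sign {x = border M · border M} {B = ⊤}
      (λ pβ _ → ¬neg (negative-border M M-sym a≈0 pβ))
      (λ β≈0 _ → ¬ker (kernel-e₀ M M-sym a≈0 (norm-zero (border M) β≈0)))
      (λ p-β _ → nonneg-norm (border M) p-β) tt)
    (λ p-a _ → ¬neg (e₀ , pos-resp (-‿cong (sym (form-e₀ M M-sym))) p-a))

  -- Shifts by multiples of the identity

  form-cong : ∀ {n} {M N : SquareMatrix n} {v w : Vector Carrier n} →
    (∀ i j → M i j ≈ N i j) → (∀ i → v i ≈ w i) → form M v ≈ form N w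
  form-cong M≈N v≈w = ·-cong v≈w (λ i → ·-cong (M≈N i) v≈w)

  δ : ∀ {n} → SquareMatrix n
  δ zero    zero    = 1#
  δ zero    (suc j) = 0#
  δ (suc i) zero    = 0#
  δ (suc i) (suc j) = δ i j

  δ-symmetric : ∀ {n} → Symmetric (δ {n})
  δ-symmetric zero    zero    = refl
  δ-symmetric zero    (suc j) = refl
  δ-symmetric (suc i) zero    = refl
  δ-symmetric (suc i) (suc j) = δ-symmetric i j

  δ-· : ∀ {n} (v : Vector Carrier n) i → δ i · v ≈ v i
  δ-· v zero = trans (+-cong (*-identityˡ (v zero)) (trans (·-comm _ (tail v)) (·-zeroʳ (tail v))))
    (+-identityʳ (v zero))
  δ-· v (suc i) = trans (+-cong (zeroˡ (v zero)) (δ-· (tail v) i)) (+-identityˡ (v (suc i)))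

  infixl 6 _-δ_
  _-δ_ : ∀ {n} → SquareMatrix n → Carrier → SquareMatrix n
  (M -δ q) i j = M i j + (- q) * δ i j

  -δ-symmetric : ∀ {n} {M : SquareMatrix n} q → Symmetric M → Symmetric (M -δ q)
  -δ-symmetric q M-sym i j = +-cong (M-sym i j) (*-congˡ (δ-symmetric i j))

  -δ-· : ∀ {n} (M : SquareMatrix n) q v i → (M -δ q) i · v ≈ M i · v - q * v i
  -δ-· M q v i = begin
    (M -δ q) i · v
      ≈⟨ ·-cong (λ j → +-congʳ (sym (*-identityˡ (M i j)))) (λ _ → refl) ⟩
    (λ j → 1# * M i j + (- q) * δ i j) · v
      ≈⟨ ·-linearˡ (M i) (δ i) v 1# (- q) ⟩
    1# * M i · v + (- q) * δ i · v
      ≈⟨ +-cong (*-identityˡ _) (trans (*-congˡ (δ-· v i)) (sym (-‿distribˡ-* q (v i)))) ⟩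
    M i · v - q * v i ∎

  form--δ : ∀ {n} (M : SquareMatrix n) q v → form (M -δ q) v ≈ form M v - q * v · v
  form--δ M q v = begin
    form (M -δ q) v
      ≈⟨ ·-cong (λ _ → refl) (λ i → trans (-δ-· M q v i)
           (+-cong (sym (*-identityˡ _)) (-‿distribˡ-* q (v i)))) ⟩
    v · (λ i → 1# * M i · v + (- q) * v i)
      ≈⟨ ·-linearʳ v (λ i → M i · v) v 1# (- q) ⟩
    1# * form M v + (- q) * v · v
      ≈⟨ +-cong (*-identityˡ _) (sym (-‿distribˡ-* q _)) ⟩
    form M v - q * v · v ∎

  nonzero⇒¬¬pos-norm : ∀ {n} (v : Vector Carrier n) → ¬ (∀ i → v i ≈ 0#) → ¬ ¬ Pos (v · v)
  nonzero⇒¬¬pos-norm v v≉0 k = v≉0 (norm-zero v (tight k (nonneg-norm v)))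

  -- By `¬¬posDef`, a matrix that is not positive definite cannot be without both kernel vectors and
  -- negative directions. On the former the form is 0, and both kinds have positive norm up to
  -- double negation.
  ¬posDef⇒nonpositive : ∀ {n} (M : SquareMatrix n) → Symmetric M → ¬ PosDef M →
    ¬ ¬ (∃[ v ] (Pos (v · v) × Nonneg (- form M v)))
  ¬posDef⇒nonpositive M M-sym ¬pd k = ¬¬posDef M M-sym
    (λ (v , v≉0 , Mv≈0) → nonzero⇒¬¬pos-norm v v≉0 λ p → k (v , p ,
      zero⇒nonneg (trans (-‿cong (trans (·-cong (λ _ → refl) Mv≈0) (·-zeroʳ v))) -0#≈0#)))
    (λ (v , p) → nonzero⇒¬¬pos-norm v
      (λ v≈0 → ¬pos-0 (pos-resp (trans (-‿cong (trans (·-comm v _)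
        (trans (·-cong (λ _ → refl) v≈0) (·-zeroʳ (λ i → M i · v))))) -0#≈0#) p))
      (λ q → k (v , q , pos⇒nonneg p)))
    ¬pd


  kernel--δ⇒eigenvector : ∀ {n} {M : SquareMatrix n} {q} → Kernel (M -δ q) →
    ∃[ v ] (¬ (∀ i → v i ≈ 0#) × ∀ i → M i · v ≈ q * v i)
  kernel--δ⇒eigenvector {M = M} {q} (v , v≉0 , h) = v , v≉0 , λ i → begin
    M i · v                       ≈⟨ solve 2 (λ s t → s := (s :- t) :+ t) refl (M i · v) (q * v i) ⟩
    (M i · v - q * v i) + q * v i ≈⟨ +-congʳ (trans (sym (-δ-· M q v i)) (h i)) ⟩
    0# + q * v i                  ≈⟨ +-identityˡ _ ⟩
    q * v i                       ∎

  bound⇒¬negative : ∀ {n} {M : SquareMatrix n} {q} →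
    (∀ v → Nonneg (form M v - q * v · v)) → ¬ Negative (M -δ q)
  bound⇒¬negative {M = M} {q} h (v , p) = nonneg-resp (sym (form--δ M q v)) (h v) p

  -- Coercivity at w gives e |w|² ≤ D (M(w) - q |w|²) ≤ D η |w|², which contradicts e > D η.
  attained⇒¬coercive : ∀ {n} {M : SquareMatrix n} {q} →
    (∀ e D → Pos e → Pos D → ¬ ¬ (∃[ η ] ∃[ w ]
      (Pos (e - D * η) × Pos (w · w) × Nonneg ((q + η) * w · w - form M w)))) →
    ¬ Coercive (M -δ q)
  attained⇒¬coercive {M = M} {q} h (e , D , pe , pD , coercive) =
    h e D pe pD λ (η , w , p , pw , nw) →
      ¬¬pos-+-nonneg (pos-* p pw) (nonneg-* (pos⇒nonneg pD) nw) λ pos →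
        coercive w (pos-resp (begin
          (e - D * η) * w · w + D * ((q + η) * w · w - form M w)
            ≈⟨ solve 6 (λ e D η q s f → (e :- D :* η) :* s :+ D :* ((q :+ η) :* s :- f)
                 := :- (D :* (f :- q :* s) :- e :* s)) refl e D η q (w · w) (form M w) ⟩
          - (D * (form M w - q * w · w) - e * w · w)
            ≈⟨ -‿cong (+-congʳ (*-congˡ (form--δ M q w))) ⟨
          - (D * form (M -δ q) w - e * w · w) ∎) pos)

  -- The last hypothesis says that no q + e/D with e, D > 0 is a lower bound.
  infimum⇒¬¬kernel : ∀ {n} {M : SquareMatrix n} {q} → Symmetric M →
    (∀ v → Nonneg (form M v - q * v · v)) →
    (∀ e D → Pos e → Pos D → ¬ ¬ (∃[ η ] ∃[ w ]
      (Pos (e - D * η) × Pos (w · w) × Nonneg ((q + η) * w · w - form M w)))) →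
    ¬ ¬ Kernel (M -δ q)
  infimum⇒¬¬kernel {M = M} {q} M-sym bound attained ¬ker =
    ¬¬posDef (M -δ q) M-δq-sym ¬ker (bound⇒¬negative bound)
      (λ pd → posDef⇒coercive (M -δ q) M-δq-sym pd (attained⇒¬coercive attained))
    where M-δq-sym = -δ-symmetric {M = M} q M-sym

  -- Lower bounds for the form

  -- The expression is |u + v|², expanded.
  nonneg-polarization : ∀ {n} (u v : Vector Carrier n) →
    Nonneg (u · u + v · v + (u · v + u · v))
  nonneg-polarization {zero} u v = nonneg-+ (nonneg-+ nonneg-0 nonneg-0) (nonneg-+ nonneg-0 nonneg-0)
  nonneg-polarization {suc n} u v = nonneg-resp
    (solve 5 (λ u v p q r →
      (u :+ v) :* (u :+ v) :+ (p :+ q :+ (r :+ r))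
        := u :* u :+ p :+ (v :* v :+ q) :+ (u :* v :+ r :+ (u :* v :+ r)))
      refl (u zero) (v zero) (tail u · tail u) (tail v · tail v) (tail u · tail v))
    (nonneg-+ (nonneg-square (u zero + v zero)) (nonneg-polarization (tail u) (tail v)))

  -- `·-bound` is added up over the rows. Their number m is separate from n so that induction can
  -- remove one row at a time.
  image-bound : ∀ {m n} (M : Fin m → Vector Carrier n) →
    ∃[ B ] (Nonneg B × ∀ v → Nonneg (B * v · v - (λ i → M i · v) · (λ i → M i · v)))
  image-bound {zero} M = 0# , nonneg-0 , λ v → zero⇒nonneg
    (trans (+-cong (zeroˡ _) -0#≈0#) (+-identityˡ 0#))
  image-bound {suc m} M with ·-bound (M zero) | image-bound (tail M)
  ... | B , nB , h | B′ , nB′ , h′ = B + B′ , nonneg-+ nB nB′ , λ v → nonneg-resp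
    (solve 5 (λ B B′ s p q → (B :* s :- p) :+ (B′ :* s :- q) := (B :+ B′) :* s :- (p :+ q))
      refl B B′ (v · v) (M zero · v * M zero · v) ((λ i → M (suc i) · v) · (λ i → M (suc i) · v)))
    (nonneg-+ (h v) (h′ v))

  -- This supplies a starting point for the bisection. From |v + Mv|² ≥ 0 and |Mv|² ≤ B |v|² follows
  -- 2 M(v) ≥ -(1 + B) |v|², so M + (1 + B) I has no value ≤ 0 at a vector of positive norm.
  shift⇒¬¬posDef : ∀ {n} (M : SquareMatrix n) → Symmetric M →
    ∃[ q ] (Nonneg q × ¬ ¬ PosDef (M -δ (- q)))
  shift⇒¬¬posDef M M-sym with B , nB , h ← image-bound M =
    1# + B , nonneg-+ n1 nB , λ ¬pd →
      ¬posDef⇒nonpositive (M -δ (- q)) (-δ-symmetric {M = M} (- q) M-sym) ¬pd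
        λ (v , pv , nv) → let
          Mv = λ i → M i · v
          s = v · v
          t = Mv · Mv
          f = form M v
        in ¬¬pos-+-nonneg pv (nonneg-+
            (nonneg-+ (nonneg-+ (nonneg-polarization v Mv) (h v)) (nonneg-* nB (nonneg-norm v)))
            (nonneg-+ nv nv))
          λ p → ¬pos-0 (pos-resp (begin
            s + (((s + t + (f + f)) + (B * s - t) + B * s)
              + (- form (M -δ (- q)) v + - form (M -δ (- q)) v))
              ≈⟨ +-congˡ (+-congˡ (+-cong (-‿cong (form--δ M (- q) v)) (-‿cong (form--δ M (- q) v)))) ⟩
            s + (((s + t + (f + f)) + (B * s - t) + B * s)
              + (- (f - (- q) * s) + - (f - (- q) * s)))
              -- The unit enters the identity as an unknown `o`; the two remainders s - 1 s are
              -- removed afterwards by `s-1s`.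
              ≈⟨ solve 5 (λ o B s t f → let e = :- (f :- (:- (o :+ B)) :* s) in
                   s :+ (((s :+ t :+ (f :+ f)) :+ (B :* s :- t) :+ B :* s) :+ (e :+ e))
                     := (s :- o :* s) :+ (s :- o :* s))
                 refl 1# B s t f ⟩
            (s - 1# * s) + (s - 1# * s)
              ≈⟨ +-cong s-1s s-1s ⟩
            0# + 0#
              ≈⟨ +-identityˡ 0# ⟩
            0# ∎) p)
    where
    q = 1# + B
    n1 = pos⇒nonneg pos-1
    s-1s : ∀ {s} → s - 1# * s ≈ 0#
    s-1s {s} = trans (+-congˡ (-‿cong (*-identityˡ s))) (-‿inverseʳ s)

  nonneg-bound-antitone : ∀ {f s p q} → Nonneg s → Nonneg (q - p) → Nonneg (f - q * s) →
    Nonneg (f - p * s)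
  nonneg-bound-antitone {f} {s} {p} {q} ns nq nf = nonneg-resp
    (solve 4 (λ f s p q → (f :- q :* s) :+ (q :- p) :* s := f :- p :* s) refl f s p q)
    (nonneg-+ nf (nonneg-* nq ns))

  form-symmetric : ∀ {n} {M : SquareMatrix n} → Symmetric M → ∀ u v →
    u · (λ i → M i · v) ≈ v · (λ i → M i · u)
  form-symmetric {M = M} M-sym u v = begin
    u · (λ i → M i · v)
      ≈⟨ sum-cong-≋ (λ i → *-distribˡ-sum (u i) (λ j → M i j * v j)) ⟩
    sum (λ i → sum (λ j → u i * (M i j * v j)))
      ≈⟨ ∑-comm (λ i j → u i * (M i j * v j)) ⟩
    sum (λ j → sum (λ i → u i * (M i j * v j)))
      ≈⟨ sum-cong-≋ (λ j → trans
           (sum-cong-≋ (λ i → trans (*-congˡ (*-congʳ (M-sym i j)))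
             (solve 3 (λ u m v → u :* (m :* v) := v :* (m :* u)) refl (u i) (M j i) (v j))))
           (sym (*-distribˡ-sum (v j) (λ i → M j i * u i)))) ⟩
    v · (λ i → M i · u) ∎

open ≡ using (_≡_; refl; sym; trans; cong; cong₂; subst; subst₂; module ≡-Reasoning)

-- The ordered algebras of rational and of real numbers

rationals : OrderedAlgebra
rationals = record
  { commutativeRing = ℚ.+-*-commutativeRing
  ; scalars  = record
    { ⟦_⟧    = λ q → q
    ; +-homo = λ _ _ → refl
    ; *-homo = λ _ _ → refl
    ; -‿homo = λ _ → refl
    ; 0-homo = refl
    ; 1-homo = refl
    }
  ; Pos      = 0ℚ ℚ.<_
  ; pos-resp = subst (0ℚ ℚ.<_)
  ; pos-1    = ℚ.positive⁻¹ 1ℚ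
  ; ¬pos-0   = ℚ.<-irrefl refl
  ; pos-+    = ℚ.+-mono-<
  ; pos-*    = λ {x} {y} x>0 y>0 →
      ℚ.positive⁻¹ _ {{ℚ.pos*pos⇒pos x {{ℚ.positive x>0}} y {{ℚ.positive y>0}}}}
  ; tight    = λ {x} x≯0 -x≯0 → ℚ.≤-antisym (ℚ.≮⇒≥ x≯0)
      (subst (0ℚ ℚ.≤_) (solve 1 (λ x → :- :- x := x) refl x) (ℚ.neg-antimono-≤ (ℚ.≮⇒≥ -x≯0)))
  }
  where open +-*-Solver

-- Rational estimates, and the ring and order structure of the reals

p≤∣p∣ : ∀ p → p ℚ.≤ ℚ.∣ p ∣
p≤∣p∣ p with ℚ.≤-total 0ℚ p
... | inj₁ 0≤p = ℚ.≤-reflexive (sym (ℚ.0≤p⇒∣p∣≡p 0≤p))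
... | inj₂ p≤0 = ℚ.≤-trans p≤0 (ℚ.0≤∣p∣ p)

∣p-q∣≤ε⇒p≤q+ε : ∀ p q {ε} → ℚ.∣ p ℚ.- q ∣ ℚ.≤ ε → p ℚ.≤ q ℚ.+ ε
∣p-q∣≤ε⇒p≤q+ε p q {ε} h = begin
  p               ≡⟨ solve 2 (λ p q → p := q :+ (p :- q)) refl p q ⟩
  q ℚ.+ (p ℚ.- q) ≤⟨ ℚ.+-monoʳ-≤ q (ℚ.≤-trans (p≤∣p∣ (p ℚ.- q)) h) ⟩
  q ℚ.+ ε         ∎
  where
  open +-*-Solver
  open ℚ.≤-Reasoning

+-cancelʳ-≤ : ∀ r p q → p ℚ.+ r ℚ.≤ q ℚ.+ r → p ℚ.≤ q
+-cancelʳ-≤ r p q h = subst₂ ℚ._≤_ (cancel p) (cancel q) (ℚ.+-monoˡ-≤ (ℚ.- r) h)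
  where
  open +-*-Solver
  cancel = λ s → solve 2 (λ s r → s :+ r :- r := s) refl s r

∣∣-≤ : ∀ p {ε} → p ℚ.≤ ε → ℚ.- p ℚ.≤ ε → ℚ.∣ p ∣ ℚ.≤ ε
∣∣-≤ p {ε} h k with ℚ.∣p∣≡p∨∣p∣≡-p p
... | inj₁ e = subst (ℚ._≤ ε) (sym e) h
... | inj₂ e = subst (ℚ._≤ ε) (sym e) k

≗⇒≈ : ∀ {x y : ℝ} → (∀ n → seq x n ≡ seq y n) → x ≈ℝ y
≗⇒≈ {x} {y} x≗y ε ε>0 = 0 , λ n _ → begin
  ℚ.∣ seq x n ℚ.- seq y n ∣ ≡⟨ cong (λ q → ℚ.∣ q ℚ.- seq y n ∣) (x≗y n) ⟩
  ℚ.∣ seq y n ℚ.- seq y n ∣ ≡⟨ cong ℚ.∣_∣ (ℚ.+-inverseʳ (seq y n)) ⟩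
  0ℚ                      ≤⟨ ℚ.<⇒≤ ε>0 ⟩
  ε                       ∎
  where open ℚ.≤-Reasoning

∣p-q∣≡∣q-p∣ : ∀ p q → ℚ.∣ p ℚ.- q ∣ ≡ ℚ.∣ q ℚ.- p ∣
∣p-q∣≡∣q-p∣ p q = trans (sym (ℚ.∣-p∣≡∣p∣ (p ℚ.- q)))
  (cong ℚ.∣_∣ (solve 2 (λ p q → :- (p :- q) := q :- p) refl p q))
  where open +-*-Solver

≈ℝ-isEquivalence : IsEquivalence _≈ℝ_
≈ℝ-isEquivalence = record
  { refl  = λ {x} → ≗⇒≈ {x} {x} (λ _ → refl)
  ; sym   = λ {x} {y} x≈y ε ε>0 → let N , h = x≈y ε ε>0 in
      N , λ n n≥N → subst (ℚ._≤ ε) (∣p-q∣≡∣q-p∣ (seq x n) (seq y n)) (h n n≥N)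
  ; trans = λ {x} {y} {z} x≈y y≈z ε ε>0 → let
      M , h = x≈y (½ ℚ.* ε) (½*pos ε>0)
      N , k = y≈z (½ ℚ.* ε) (½*pos ε>0)
    in M ⊔ N , λ n n≥ → begin
      ℚ.∣ seq x n ℚ.- seq z n ∣
        ≡⟨ cong ℚ.∣_∣ (solve 3 (λ x y z → x :- z := (x :- y) :+ (y :- z)) refl
             (seq x n) (seq y n) (seq z n)) ⟩
      ℚ.∣ (seq x n ℚ.- seq y n) ℚ.+ (seq y n ℚ.- seq z n) ∣
        ≤⟨ ℚ.∣p+q∣≤∣p∣+∣q∣ (seq x n ℚ.- seq y n) (seq y n ℚ.- seq z n) ⟩
      ℚ.∣ seq x n ℚ.- seq y n ∣ ℚ.+ ℚ.∣ seq y n ℚ.- seq z n ∣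
        ≤⟨ ℚ.+-mono-≤ (h n (left n≥)) (k n (right {M} n≥)) ⟩
      ½ ℚ.* ε ℚ.+ ½ ℚ.* ε
        ≡⟨ halves ε ⟩
      ε ∎
  }
  where
  open +-*-Solver
  open ℚ.≤-Reasoning

+ℝ-cong : ∀ {x x′ y y′} → x ≈ℝ x′ → y ≈ℝ y′ → x +ℝ y ≈ℝ x′ +ℝ y′
+ℝ-cong {x} {x′} {y} {y′} x≈ y≈ ε ε>0 =
  let M , h = x≈ (½ ℚ.* ε) (½*pos ε>0)
      N , k = y≈ (½ ℚ.* ε) (½*pos ε>0)
  in M ⊔ N , λ n n≥ → begin
    ℚ.∣ (seq x n ℚ.+ seq y n) ℚ.- (seq x′ n ℚ.+ seq y′ n) ∣
      ≡⟨ cong ℚ.∣_∣ (sub-+ (seq x n) (seq y n) (seq x′ n) (seq y′ n)) ⟩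
    ℚ.∣ (seq x n ℚ.- seq x′ n) ℚ.+ (seq y n ℚ.- seq y′ n) ∣
      ≤⟨ ℚ.∣p+q∣≤∣p∣+∣q∣ (seq x n ℚ.- seq x′ n) (seq y n ℚ.- seq y′ n) ⟩
    ℚ.∣ seq x n ℚ.- seq x′ n ∣ ℚ.+ ℚ.∣ seq y n ℚ.- seq y′ n ∣
      ≤⟨ ℚ.+-mono-≤ (h n (left n≥)) (k n (right {M} n≥)) ⟩
    ½ ℚ.* ε ℚ.+ ½ ℚ.* ε
      ≡⟨ halves ε ⟩
    ε ∎
  where open ℚ.≤-Reasoning

*ℝ-cong : ∀ {x x′ y y′} → x ≈ℝ x′ → y ≈ℝ y′ → x *ℝ y ≈ℝ x′ *ℝ y′
*ℝ-cong {x} {x′} {y} {y′} x≈ y≈ ε ε>0 =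
  let a , a>0 , A , ha = bounded (cauchy x)
      b , b>0 , B , hb = bounded (cauchy y′)
      δ , δ>0 , aδ = shrink a a>0 (½ ℚ.* ε) (½*pos ε>0)
      η , η>0 , bη = shrink b b>0 (½ ℚ.* ε) (½*pos ε>0)
      M , hx = x≈ η η>0
      N , hy = y≈ δ δ>0
  in (A ⊔ B) ⊔ (M ⊔ N) , λ n n≥ →
    let n≥A⊔B = left {A ⊔ B} {M ⊔ N} n≥
        n≥M⊔N = right {A ⊔ B} {M ⊔ N} n≥
    in begin
    ℚ.∣ seq x n ℚ.* seq y n ℚ.- seq x′ n ℚ.* seq y′ n ∣
      ≡⟨ cong ℚ.∣_∣ (sub-* (seq x n) (seq y n) (seq x′ n) (seq y′ n)) ⟩
    ℚ.∣ seq x n ℚ.* (seq y n ℚ.- seq y′ n) ℚ.+ (seq x n ℚ.- seq x′ n) ℚ.* seq y′ n ∣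
      ≤⟨ ℚ.∣p+q∣≤∣p∣+∣q∣ (seq x n ℚ.* (seq y n ℚ.- seq y′ n)) ((seq x n ℚ.- seq x′ n) ℚ.* seq y′ n) ⟩
    ℚ.∣ seq x n ℚ.* (seq y n ℚ.- seq y′ n) ∣ ℚ.+ ℚ.∣ (seq x n ℚ.- seq x′ n) ℚ.* seq y′ n ∣
      ≤⟨ ℚ.+-mono-≤
           (∣∣-mono-* (seq x n) a (seq y n ℚ.- seq y′ n) δ (ℚ.<⇒≤ a>0)
             (ha n (left {A} {B} n≥A⊔B)) (hy n (right {M} {N} n≥M⊔N)))
           (∣∣-mono-* (seq x n ℚ.- seq x′ n) η (seq y′ n) b (ℚ.<⇒≤ η>0)
             (hx n (left {M} {N} n≥M⊔N)) (hb n (right {A} {B} n≥A⊔B))) ⟩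
    a ℚ.* δ ℚ.+ η ℚ.* b
      ≡⟨ cong₂ ℚ._+_ aδ (trans (ℚ.*-comm η b) bη) ⟩
    ½ ℚ.* ε ℚ.+ ½ ℚ.* ε
      ≡⟨ halves ε ⟩
    ε ∎
  where open ℚ.≤-Reasoning

-ℝ-cong : ∀ {x y} → x ≈ℝ y → -ℝ x ≈ℝ -ℝ y
-ℝ-cong {x} {y} x≈y ε ε>0 = let N , h = x≈y ε ε>0 in N , λ n n≥N →
  subst (ℚ._≤ ε)
    (trans (∣p-q∣≡∣q-p∣ (seq x n) (seq y n))
      (cong ℚ.∣_∣ (solve 2 (λ x y → y :- x := :- x :- :- y) refl (seq x n) (seq y n))))
    (h n n≥N)
  where open +-*-Solver

ℝ-isCommutativeRing : IsCommutativeRing _≈ℝ_ _+ℝ_ _*ℝ_ -ℝ_ 0ℝ 1ℝ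
ℝ-isCommutativeRing = record
  { isRing = record
    { +-isAbelianGroup = record
      { isGroup = record
        { isMonoid = record
          { isSemigroup = record
            { isMagma = record
              { isEquivalence = ≈ℝ-isEquivalence
              ; ∙-cong = λ {x} {x′} {y} {y′} → +ℝ-cong {x} {x′} {y} {y′}
              }
            ; assoc = λ x y z → ≗⇒≈ {(x +ℝ y) +ℝ z} {x +ℝ (y +ℝ z)}
                (λ n → ℚ.+-assoc (seq x n) (seq y n) (seq z n))
            }
          ; identity = (λ x → ≗⇒≈ {0ℝ +ℝ x} {x} (λ n → ℚ.+-identityˡ (seq x n)))
                     , (λ x → ≗⇒≈ {x +ℝ 0ℝ} {x} (λ n → ℚ.+-identityʳ (seq x n)))
          }
        ; inverse = (λ x → ≗⇒≈ {(-ℝ x) +ℝ x} {0ℝ} (λ n → ℚ.+-inverseˡ (seq x n)))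
                  , (λ x → ≗⇒≈ {x +ℝ (-ℝ x)} {0ℝ} (λ n → ℚ.+-inverseʳ (seq x n)))
        ; ⁻¹-cong = λ {x} {y} → -ℝ-cong {x} {y}
        }
      ; comm = λ x y → ≗⇒≈ {x +ℝ y} {y +ℝ x} (λ n → ℚ.+-comm (seq x n) (seq y n))
      }
    ; *-cong = λ {x} {x′} {y} {y′} → *ℝ-cong {x} {x′} {y} {y′}
    ; *-assoc = λ x y z → ≗⇒≈ {(x *ℝ y) *ℝ z} {x *ℝ (y *ℝ z)}
        (λ n → ℚ.*-assoc (seq x n) (seq y n) (seq z n))
    ; *-identity = (λ x → ≗⇒≈ {1ℝ *ℝ x} {x} (λ n → ℚ.*-identityˡ (seq x n)))
                 , (λ x → ≗⇒≈ {x *ℝ 1ℝ} {x} (λ n → ℚ.*-identityʳ (seq x n)))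
    ; distrib =
        (λ x y z → ≗⇒≈ {x *ℝ (y +ℝ z)} {x *ℝ y +ℝ x *ℝ z}
          (λ n → ℚ.*-distribˡ-+ (seq x n) (seq y n) (seq z n)))
      , (λ x y z → ≗⇒≈ {(y +ℝ z) *ℝ x} {y *ℝ x +ℝ z *ℝ x}
          (λ n → ℚ.*-distribʳ-+ (seq x n) (seq y n) (seq z n)))
    }
  ; *-comm = λ x y → ≗⇒≈ {x *ℝ y} {y *ℝ x} (λ n → ℚ.*-comm (seq x n) (seq y n))
  }

ℝ-commutativeRing : CommutativeRing 0ℓ 0ℓ
ℝ-commutativeRing = record { isCommutativeRing = ℝ-isCommutativeRing }

-- A positive lower bound for the late terms is required, since positive terms may tend to zero.
Posℝ : ℝ → Set
Posℝ x = ∃[ ε ] (0ℚ ℚ.< ε × ∃[ N ] (∀ n → n ≥ N → ε ℚ.≤ seq x n))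

Posℝ-resp : ∀ {x y} → x ≈ℝ y → Posℝ x → Posℝ y
Posℝ-resp {x} {y} x≈y (ε , ε>0 , M , h) =
  let N , k = x≈y (½ ℚ.* ε) (½*pos ε>0) in
  ½ ℚ.* ε , ½*pos ε>0 , M ⊔ N , λ n n≥ → begin
    ½ ℚ.* ε
      ≡⟨ trans (cong (ℚ._- ½ ℚ.* ε) (sym (halves ε)))
           (solve 1 (λ δ → (δ :+ δ) :- δ := δ) refl (½ ℚ.* ε)) ⟨
    ε ℚ.- ½ ℚ.* ε
      ≤⟨ ℚ.+-mono-≤ (h n (left n≥))
           (ℚ.neg-antimono-≤ (ℚ.≤-trans (p≤∣p∣ _) (k n (right {M} n≥)))) ⟩
    seq x n ℚ.- (seq x n ℚ.- seq y n)
      ≡⟨ solve 2 (λ x y → x :- (x :- y) := y) refl (seq x n) (seq y n) ⟩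
    seq y n ∎
  where
  open +-*-Solver
  open ℚ.≤-Reasoning

Posℝ-+ : ∀ {x y} → Posℝ x → Posℝ y → Posℝ (x +ℝ y)
Posℝ-+ (δ , δ>0 , M , h) (ε , ε>0 , N , k) =
  δ ℚ.+ ε , ℚ.+-mono-< δ>0 ε>0 , M ⊔ N , λ n n≥ →
    ℚ.+-mono-≤ (h n (left n≥)) (k n (right {M} n≥))

*-mono-≤-nonNeg : ∀ {p q r s} → 0ℚ ℚ.≤ p → 0ℚ ℚ.≤ s → p ℚ.≤ q → r ℚ.≤ s → p ℚ.* r ℚ.≤ q ℚ.* s
*-mono-≤-nonNeg {p} {q} {r} {s} 0≤p 0≤s p≤q r≤s = ℚ.≤-trans
  (ℚ.*-monoˡ-≤-nonNeg p {{ℚ.nonNegative 0≤p}} r≤s)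
  (ℚ.*-monoʳ-≤-nonNeg s {{ℚ.nonNegative 0≤s}} p≤q)

Posℝ-* : ∀ {x y} → Posℝ x → Posℝ y → Posℝ (x *ℝ y)
Posℝ-* {x} {y} (δ , δ>0 , M , h) (ε , ε>0 , N , k) =
  δ ℚ.* ε , OrderedAlgebra.pos-* rationals δ>0 ε>0 , M ⊔ N , λ n n≥ →
    *-mono-≤-nonNeg (ℚ.<⇒≤ δ>0) (ℚ.≤-trans (ℚ.<⇒≤ ε>0) (k n (right {M} n≥)))
      (h n (left n≥)) (k n (right {M} n≥))

-- Whether the limit is positive is decided, up to ε, by a single late term.
¬Posℝ⇒≤ : ∀ {x} → ¬ Posℝ x → ∀ ε → 0ℚ ℚ.< ε → ∃[ N ] (∀ n → n ≥ N → seq x n ℚ.≤ ε)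
¬Posℝ⇒≤ {x} ¬p ε ε>0 = N , below (seq x N ℚ.≤? ½ ℚ.* ε)
  where
  open ℚ.≤-Reasoning
  -- With δ = ε/4, a term x N ≤ ε/2 keeps all later terms at most 3ε/4, while x N > ε/2 keeps them
  -- at least ε/2 - δ = δ, which would make x positive.
  δ = ½ ℚ.* (½ ℚ.* ε)
  δ>0 = ½*pos (½*pos ε>0)
  N = proj₁ (cauchy x δ δ>0)
  close = proj₂ (cauchy x δ δ>0)

  δ≤½ε : δ ℚ.≤ ½ ℚ.* ε
  δ≤½ε = subst₂ ℚ._≤_ (ℚ.+-identityʳ δ) (halves (½ ℚ.* ε)) (ℚ.+-monoʳ-≤ δ (ℚ.<⇒≤ δ>0))

  below : Dec (seq x N ℚ.≤ ½ ℚ.* ε) → ∀ n → n ≥ N → seq x n ℚ.≤ ε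
  below (yes xN≤½ε) n n≥N = begin
    seq x n             ≤⟨ ∣p-q∣≤ε⇒p≤q+ε (seq x n) (seq x N) (close n N n≥N ℕ.≤-refl) ⟩
    seq x N ℚ.+ δ       ≤⟨ ℚ.+-mono-≤ xN≤½ε δ≤½ε ⟩
    ½ ℚ.* ε ℚ.+ ½ ℚ.* ε ≡⟨ halves ε ⟩
    ε                   ∎
  below (no xN≰½ε) _ _ = contradiction
    (δ , δ>0 , N , λ n n≥N → +-cancelʳ-≤ δ δ (seq x n) (begin
      δ ℚ.+ δ         ≡⟨ halves (½ ℚ.* ε) ⟩
      ½ ℚ.* ε         ≤⟨ ℚ.<⇒≤ (ℚ.≰⇒> xN≰½ε) ⟩
      seq x N         ≤⟨ ∣p-q∣≤ε⇒p≤q+ε (seq x N) (seq x n) (close N n ℕ.≤-refl n≥N) ⟩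
      seq x n ℚ.+ δ   ∎))
    ¬p

Posℝ-tight : ∀ {x} → ¬ Posℝ x → ¬ Posℝ (-ℝ x) → x ≈ℝ 0ℝ
Posℝ-tight {x} ¬px ¬p-x ε ε>0 =
  let M , h = ¬Posℝ⇒≤ {x} ¬px ε ε>0
      N , k = ¬Posℝ⇒≤ {x = -ℝ x} ¬p-x ε ε>0
  in M ⊔ N , λ n n≥ → subst (λ q → ℚ.∣ q ∣ ℚ.≤ ε) (sym (ℚ.+-identityʳ (seq x n)))
    (∣∣-≤ (seq x n) (h n (left n≥)) (k n (right {M} n≥)))

reals : OrderedAlgebra
reals = record
  { commutativeRing = ℝ-commutativeRing
  ; scalars  = record
    { ⟦_⟧    = fromℚ
    ; +-homo = λ p q → ≗⇒≈ {fromℚ (p ℚ.+ q)} {fromℚ p +ℝ fromℚ q} (λ _ → refl)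
    ; *-homo = λ p q → ≗⇒≈ {fromℚ (p ℚ.* q)} {fromℚ p *ℝ fromℚ q} (λ _ → refl)
    ; -‿homo = λ p → ≗⇒≈ {x = fromℚ (ℚ.- p)} {y = -ℝ fromℚ p} (λ _ → refl)
    ; 0-homo = ≗⇒≈ {0ℝ} {0ℝ} (λ _ → refl)
    ; 1-homo = ≗⇒≈ {1ℝ} {1ℝ} (λ _ → refl)
    }
  ; Pos      = Posℝ
  ; pos-resp = λ {x} {y} → Posℝ-resp {x} {y}
  ; pos-1    = 1ℚ , ℚ.positive⁻¹ 1ℚ , 0 , λ _ _ → ℚ.≤-refl
  ; ¬pos-0   = λ (ε , ε>0 , N , h) → ℚ.<-irrefl refl (ℚ.<-≤-trans ε>0 (h N ℕ.≤-refl))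
  ; pos-+    = λ {x} {y} → Posℝ-+ {x} {y}
  ; pos-*    = λ {x} {y} → Posℝ-* {x} {y}
  ; tight    = λ {x} → Posℝ-tight {x}
  }

module ℚF = OrderedAlgebraProperties rationals
module ℝF = OrderedAlgebraProperties reals

-- Natural numbers among the rationals and the Archimedean property

ι : ℕ → ℚ
ι n = ℤ.+ n ℚ./ 1

-- The division by 1 normalizes by a gcd and does not compute for a variable `n`; the right-hand
-- side exposes numerator and denominator.
ι≡mkℚ : ∀ n → ι n ≡ mkℚ (ℤ.+ n) 0 (coprime-sym (1-coprimeTo n))
ι≡mkℚ n = ℚ.normalize-coprime (coprime-sym (1-coprimeTo n))

toℚᵘ-ι : ∀ n → ℚ.toℚᵘ (ι n) ≡ ℚᵘ.mkℚᵘ (ℤ.+ n) 0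
toℚᵘ-ι n = cong ℚ.toℚᵘ (ι≡mkℚ n)

ι-+ : ∀ m n → ι (m ℕ.+ n) ≡ ι m ℚ.+ ι n
ι-+ m n = ℚ.toℚᵘ-injective (ℚᵘ.≃-sym (begin
  ℚ.toℚᵘ (ι m ℚ.+ ι n)                            ≈⟨ ℚ.toℚᵘ-homo-+ (ι m) (ι n) ⟩
  ℚ.toℚᵘ (ι m) ℚᵘ.+ ℚ.toℚᵘ (ι n)                  ≡⟨ cong₂ ℚᵘ._+_ (toℚᵘ-ι m) (toℚᵘ-ι n) ⟩
  ℚᵘ.mkℚᵘ (ℤ.+ m) 0 ℚᵘ.+ ℚᵘ.mkℚᵘ (ℤ.+ n) 0        ≡⟨ cong (λ z → ℚᵘ.mkℚᵘ z 0)
    (cong₂ ℤ._+_ (ℤ.*-identityʳ (ℤ.+ m)) (ℤ.*-identityʳ (ℤ.+ n))) ⟩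
  ℚᵘ.mkℚᵘ (ℤ.+ (m ℕ.+ n)) 0                       ≡⟨ toℚᵘ-ι (m ℕ.+ n) ⟨
  ℚ.toℚᵘ (ι (m ℕ.+ n))                            ∎))
  where open ℚᵘ.≃-Reasoning

ι-* : ∀ m n → ι (m ℕ.* n) ≡ ι m ℚ.* ι n
ι-* m n = ℚ.toℚᵘ-injective (ℚᵘ.≃-sym (begin
  ℚ.toℚᵘ (ι m ℚ.* ι n)                            ≈⟨ ℚ.toℚᵘ-homo-* (ι m) (ι n) ⟩
  ℚ.toℚᵘ (ι m) ℚᵘ.* ℚ.toℚᵘ (ι n)                  ≡⟨ cong₂ ℚᵘ._*_ (toℚᵘ-ι m) (toℚᵘ-ι n) ⟩
  ℚᵘ.mkℚᵘ (ℤ.+ m) 0 ℚᵘ.* ℚᵘ.mkℚᵘ (ℤ.+ n) 0        ≡⟨ cong (λ z → ℚᵘ.mkℚᵘ z 0) (ℤ.pos-* m n) ⟨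
  ℚᵘ.mkℚᵘ (ℤ.+ (m ℕ.* n)) 0                       ≡⟨ toℚᵘ-ι (m ℕ.* n) ⟨
  ℚ.toℚᵘ (ι (m ℕ.* n))                            ∎))
  where open ℚᵘ.≃-Reasoning

ι-nonNeg : ∀ n → 0ℚ ℚ.≤ ι n
ι-nonNeg n = subst (0ℚ ℚ.≤_) (sym (ι≡mkℚ n)) (ℚ.nonNegative⁻¹ (mkℚ (ℤ.+ n) 0 _))

ι-pos : ∀ n .{{_ : ℕ.NonZero n}} → 0ℚ ℚ.< ι n
ι-pos (suc n) = subst (0ℚ ℚ.<_) (sym (ι≡mkℚ (suc n))) (ℚ.positive⁻¹ (mkℚ (ℤ.+ suc n) 0 _))

-- Dropping the sign, and then the denominator, which is at least 1, can only increase the value.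
≤-ι-numerator : ∀ p → p ℚ.≤ ι ℤ.∣ ℚ.↥ p ∣
≤-ι-numerator p@(mkℚ z d c) = subst (p ℚ.≤_) (sym (ι≡mkℚ ℤ.∣ z ∣)) (ℚ.*≤* (begin
  z ℤ.* ℤ.+ 1              ≡⟨ ℤ.*-identityʳ z ⟩
  z                        ≤⟨ ≤∣∣ z ⟩
  ℤ.+ ℤ.∣ z ∣              ≡⟨ ℤ.*-identityʳ (ℤ.+ ℤ.∣ z ∣) ⟨
  ℤ.+ ℤ.∣ z ∣ ℤ.* ℤ.+ 1    ≤⟨ ℤ.*-monoˡ-≤-nonNeg (ℤ.+ ℤ.∣ z ∣) (ℤ.+≤+ (ℕ.s≤s ℕ.z≤n)) ⟩
  ℤ.+ ℤ.∣ z ∣ ℤ.* ℤ.+ suc d ∎))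
  where
  open ℤ.≤-Reasoning
  ≤∣∣ : ∀ z → z ℤ.≤ ℤ.+ ℤ.∣ z ∣
  ≤∣∣ (ℤ.+ n) = ℤ.≤-refl
  ≤∣∣ ℤ.-[1+ n ] = ℤ.-≤+

archimedean : ∀ w {ε} → 0ℚ ℚ.< ε → ∃[ N ] (w ℚ.≤ ι (suc N) ℚ.* ε)
archimedean w {ε} ε>0 = N , (begin
  w                    ≡⟨ trans (ℚ.*-assoc w (ℚ.1/ ε) ε)
                            (trans (cong (w ℚ.*_) (ℚ.*-inverseˡ ε)) (ℚ.*-identityʳ w)) ⟨
  w ℚ.* ℚ.1/ ε ℚ.* ε   ≤⟨ ℚ.*-monoʳ-≤-nonNeg ε (ℚ.≤-trans (≤-ι-numerator (w ℚ.* ℚ.1/ ε)) ιN≤) ⟩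
  ι (suc N) ℚ.* ε      ∎)
  where
  open ℚ.≤-Reasoning
  instance
    _ = ℚ.positive ε>0
    _ = ℚ.pos⇒nonNeg ε
    _ = ℚ.pos⇒nonZero ε
  -- The numerator of w/ε bounds w/ε. The bound is used with `suc N`, which is positive and can
  -- later be cancelled.
  N = ℤ.∣ ℚ.↥ (w ℚ.* ℚ.1/ ε) ∣
  ιN≤ : ι N ℚ.≤ ι (suc N)
  ιN≤ = begin
    ι N            ≡⟨ ℚ.+-identityˡ (ι N) ⟨
    0ℚ ℚ.+ ι N     ≤⟨ ℚ.+-monoˡ-≤ (ι N) (ι-nonNeg 1) ⟩
    ι 1 ℚ.+ ι N    ≡⟨ ι-+ 1 N ⟨
    ι (suc N)      ∎

-- Decidable definiteness, and signs of rationals and of real sequences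

posDef? : ∀ {n} (M : ℚF.SquareMatrix n) → Dec (ℚF.PosDef M)
posDef? {zero}  M = yes tt
posDef? {suc n} M = (0ℚ ℚ.<? ℚF.corner M) ×-dec posDef? (ℚF.schur M)

p≤q⇒0≤q-p : ∀ {p q} → p ℚ.≤ q → 0ℚ ℚ.≤ q ℚ.- p
p≤q⇒0≤q-p {p} {q} p≤q = subst (ℚ._≤ q ℚ.- p) (ℚ.+-inverseʳ p) (ℚ.+-monoˡ-≤ (ℚ.- p) p≤q)

0≤q-p⇒p≤q : ∀ {p q} → 0ℚ ℚ.≤ q ℚ.- p → p ℚ.≤ q
0≤q-p⇒p≤q {p} {q} h = subst₂ ℚ._≤_ (ℚ.+-identityˡ p)
  (solve 2 (λ p q → q :- p :+ p := q) refl p q) (ℚ.+-monoˡ-≤ p h)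
  where open +-*-Solver

nonneg⇒0≤ : ∀ {p} → ℚF.Nonneg p → 0ℚ ℚ.≤ p
nonneg⇒0≤ {p} h = subst (0ℚ ℚ.≤_) (solve 1 (λ p → :- :- p := p) refl p)
  (ℚ.neg-antimono-≤ (ℚ.≮⇒≥ h))
  where open +-*-Solver

0≤⇒nonneg : ∀ {p} → 0ℚ ℚ.≤ p → ℚF.Nonneg p
0≤⇒nonneg {p} 0≤p 0<-p = ℚ.<-irrefl refl (ℚ.<-≤-trans 0<-p (ℚ.neg-antimono-≤ 0≤p))

nonnegℝ : ∀ x M → (∀ n → n ≥ M → 0ℚ ℚ.≤ seq x n) → ℝF.Nonneg x
nonnegℝ x M h (ε , ε>0 , N , k) = 0≤⇒nonneg (h (M ⊔ N) (ℕ.m≤m⊔n M N))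
  (ℚ.<-≤-trans ε>0 (k (M ⊔ N) (ℕ.m≤n⊔m M N)))

nonnegℝ⇒≤ℝ : ∀ {x y} → ℝF.Nonneg (y -ℝ x) → x ≤ℝ y
nonnegℝ⇒≤ℝ {x} {y} h ε ε>0 =
  let N , k = ¬Posℝ⇒≤ {x = -ℝ (y -ℝ x)} h ε ε>0 in N , λ n n≥N → begin
    seq x n
      ≡⟨ solve 2 (λ x y → x := y :+ :- (y :- x)) refl (seq x n) (seq y n) ⟩
    seq y n ℚ.+ ℚ.- (seq y n ℚ.- seq x n)
      ≤⟨ ℚ.+-monoʳ-≤ (seq y n) (k n n≥N) ⟩
    seq y n ℚ.+ ε ∎
  where
  open +-*-Solver
  open ℚ.≤-Reasoning

≤ℝ⇒nonnegℝ : ∀ {x y} → x ≤ℝ y → ℝF.Nonneg (y -ℝ x)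
≤ℝ⇒nonnegℝ {x} {y} x≤y (ε , ε>0 , M , h) =
  let N , k = x≤y (½ ℚ.* ε) (½*pos ε>0)
      n = M ⊔ N
  in ℚ.<-irrefl refl (ℚ.<-≤-trans (½*pos ε>0) (0≤q-p⇒p≤q (begin
    0ℚ
      ≤⟨ p≤q⇒0≤q-p (ℚ.+-mono-≤ (h n (ℕ.m≤m⊔n M N)) (k n (ℕ.m≤n⊔m M N))) ⟩
    (ℚ.- (seq y n ℚ.- seq x n) ℚ.+ (seq y n ℚ.+ ½ ℚ.* ε)) ℚ.- (ε ℚ.+ seq x n)
      ≡⟨ solve 3 (λ x y ε → (:- (y :- x) :+ (y :+ con ½ :* ε)) :- (ε :+ x)
           := con 0ℚ :- con ½ :* ε) refl (seq x n) (seq y n) ε ⟩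
    0ℚ ℚ.- ½ ℚ.* ε ∎)))
  where
  open +-*-Solver
  open ℚ.≤-Reasoning

-- Terms of real sums and forms

seq-sum : ∀ {n} (v : Vector ℝ n) m → seq (sumℝ v) m ≡ ℚF.sum (λ i → seq (v i) m)
seq-sum {zero}  v m = refl
seq-sum {suc n} v m = cong (seq (v zero) m ℚ.+_) (seq-sum (tail v) m)

seq-· : ∀ {n} (u v : Vector ℝ n) m →
  seq (u ℝF.· v) m ≡ (λ i → seq (u i) m) ℚF.· (λ i → seq (v i) m)
seq-· u v m = seq-sum (λ i → u i *ℝ v i) m

-- Since the real operations act term by term, facts about rational vectors carry over to real ones
-- index by index.
seq-form : ∀ {n} (M : ℝF.SquareMatrix n) v m →
  seq (ℝF.form M v) m ≡ ℚF.form (λ i j → seq (M i j) m) (λ i → seq (v i) m)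
seq-form M v m = trans (seq-· v _ m)
  (ℚF.·-cong {u = λ i → seq (v i) m} (λ _ → refl) (λ i → seq-· (M i) v m))

-- Eventually e ≥ ε, the witness in `pe`, while D w ≤ b w ≤ ε/2; this leaves a gap of ε/2.
pos-gap : ∀ e D w b N (pe : Posℝ e) → (∀ n → n ≥ N → ℚ.∣ seq D n ∣ ℚ.≤ b) → 0ℚ ℚ.≤ w →
  b ℚ.* w ℚ.≤ ½ ℚ.* proj₁ pe → Posℝ (e -ℝ D *ℝ fromℚ w)
pos-gap e D w b N (ε , ε>0 , M , e≥ε) D≤b 0≤w bw≤ =
  ½ ℚ.* ε , ½*pos ε>0 , M ⊔ N , λ m m≥ → begin
    ½ ℚ.* ε
      ≡⟨ solve 1 (λ ε → con ½ :* ε := ε :- con ½ :* ε) refl ε ⟩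
    ε ℚ.- ½ ℚ.* ε
      ≤⟨ ℚ.+-mono-≤ (e≥ε m (left m≥)) (ℚ.neg-antimono-≤ (ℚ.≤-trans
           (ℚ.*-monoʳ-≤-nonNeg w {{ℚ.nonNegative 0≤w}}
             (ℚ.≤-trans (p≤∣p∣ (seq D m)) (D≤b m (right {M} m≥))))
           bw≤)) ⟩
    seq e m ℚ.- seq D m ℚ.* w ∎
  where
  open +-*-Solver
  open ℚ.≤-Reasoning

-- The least eigenvalue of a rational symmetric matrix

module _ {n} (A : ℚF.SquareMatrix n) where
  open ℚF using (_-δ_; PosDef)
  open +-*-Solver
  open ℚ.≤-Reasoning

  -- The infimum of the Rayleigh quotient is enclosed: `pd-lo` makes `lo` a lower bound, and
  -- `¬pd-hi` yields, up to double negation, a direction with quotient at most `hi`.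
  record Bracket : Set where
    field
      lo hi  : ℚ
      lo≤hi  : lo ℚ.≤ hi
      pd-lo  : PosDef (A -δ lo)
      ¬pd-hi : ¬ PosDef (A -δ hi)

    width : ℚ
    width = hi ℚ.- lo

    mid : ℚ
    mid = lo ℚ.+ ½ ℚ.* width

    lo≤mid : lo ℚ.≤ mid
    lo≤mid = subst (ℚ._≤ mid) (ℚ.+-identityʳ lo) (ℚ.+-monoʳ-≤ lo
      (ℚ.*-monoˡ-≤-nonNeg ½ (p≤q⇒0≤q-p lo≤hi)))

    hi-mid : hi ℚ.- mid ≡ ½ ℚ.* width
    hi-mid = solve 2 (λ l h → h :- (l :+ con ½ :* (h :- l)) := con ½ :* (h :- l)) refl lo hi

    mid≤hi : mid ℚ.≤ hi
    mid≤hi = 0≤q-p⇒p≤q (subst (0ℚ ℚ.≤_) (sym hi-mid)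
      (ℚ.*-monoˡ-≤-nonNeg ½ (p≤q⇒0≤q-p lo≤hi)))

  open Bracket

  record Halving (B B′ : Bracket) : Set where
    field
      lo-≤    : lo B ℚ.≤ lo B′
      hi-≥    : hi B′ ℚ.≤ hi B
      width-½ : width B′ ≡ ½ ℚ.* width B

  open Halving

  halve : ∀ B → ∃[ B′ ] Halving B B′
  halve B with posDef? (A -δ mid B)
  ... | yes pd = record { lo = mid B ; hi = hi B ; lo≤hi = mid≤hi B ; pd-lo = pd ; ¬pd-hi = ¬pd-hi B }
    , record { lo-≤ = lo≤mid B ; hi-≥ = ℚ.≤-refl ; width-½ = hi-mid B }
  ... | no ¬pd = record { lo = lo B ; hi = mid B ; lo≤hi = lo≤mid B ; pd-lo = pd-lo B ; ¬pd-hi = ¬pd }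
    , record { lo-≤ = ℚ.≤-refl ; hi-≥ = mid≤hi B
             ; width-½ = solve 2 (λ l w → l :+ w :- l := w) refl (lo B) (½ ℚ.* width B) }

  module Bisection (B₀ : Bracket) where
    bracket : ℕ → Bracket
    bracket zero    = B₀
    bracket (suc k) = proj₁ (halve (bracket k))

    halving : ∀ k → Halving (bracket k) (bracket (suc k))
    halving k = proj₂ (halve (bracket k))

    lo-mono : ∀ {j k} → j ℕ.≤′ k → lo (bracket j) ℚ.≤ lo (bracket k)
    lo-mono ℕ.≤′-refl = ℚ.≤-refl
    lo-mono (ℕ.≤′-step {k} j≤k) = ℚ.≤-trans (lo-mono j≤k) (lo-≤ (halving k))

    hi-anti : ∀ {j k} → j ℕ.≤′ k → hi (bracket k) ℚ.≤ hi (bracket j)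
    hi-anti ℕ.≤′-refl = ℚ.≤-refl
    hi-anti (ℕ.≤′-step {k} j≤k) = ℚ.≤-trans (hi-≥ (halving k)) (hi-anti j≤k)

    width-≤ : ∀ k → width (bracket k) ℚ.≤ width B₀
    width-≤ k = ℚ.+-mono-≤ (hi-anti 0≤k) (ℚ.neg-antimono-≤ (lo-mono 0≤k))
      where 0≤k = ℕ.≤⇒≤′ (ℕ.z≤n {k})

    -- The width decays like 2 to the power -k, but the rate 1/k suffices and fits `archimedean`. In
    -- the step, (1 + k) w/2 is w/2 + (k w)/2, and each summand is at most half the initial width.
    ι*width-≤ : ∀ k → ι k ℚ.* width (bracket k) ℚ.≤ width B₀
    ι*width-≤ zero = subst (ℚ._≤ width B₀) (sym (ℚ.*-zeroˡ (width B₀))) (p≤q⇒0≤q-p (lo≤hi B₀))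
    ι*width-≤ (suc k) = begin
      ι (suc k) ℚ.* width (bracket (suc k))
        ≡⟨ cong₂ ℚ._*_ (ι-+ 1 k) (width-½ (halving k)) ⟩
      (1ℚ ℚ.+ ι k) ℚ.* (½ ℚ.* w)
        ≡⟨ solve 2 (λ i w → (con 1ℚ :+ i) :* (con ½ :* w) := con ½ :* w :+ con ½ :* (i :* w))
             refl (ι k) w ⟩
      ½ ℚ.* w ℚ.+ ½ ℚ.* (ι k ℚ.* w)
        ≤⟨ ℚ.+-mono-≤ (ℚ.*-monoˡ-≤-nonNeg ½ (width-≤ k)) (ℚ.*-monoˡ-≤-nonNeg ½ (ι*width-≤ k)) ⟩
      ½ ℚ.* width B₀ ℚ.+ ½ ℚ.* width B₀
        ≡⟨ halves (width B₀) ⟩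
      width B₀ ∎
      where w = width (bracket k)

    width-small : ∀ ε → 0ℚ ℚ.< ε → ∃[ k ] (width (bracket k) ℚ.≤ ε)
    width-small ε ε>0 = suc N ,
      ℚ.*-cancelˡ-≤-pos {p = width (bracket (suc N))} {q = ε} (ι (suc N))
        {{ℚ.positive (ι-pos (suc N))}} (ℚ.≤-trans (ι*width-≤ (suc N)) (proj₂ bound))
      where
      bound = archimedean (width B₀) ε>0
      N = proj₁ bound

    lo-close : ∀ N m k → m ≥ N → k ≥ N →
      lo (bracket m) ℚ.- lo (bracket k) ℚ.≤ width (bracket N)
    lo-close N m k m≥N k≥N = ℚ.+-mono-≤
      (ℚ.≤-trans (lo≤hi (bracket m)) (hi-anti (ℕ.≤⇒≤′ m≥N)))
      (ℚ.neg-antimono-≤ (lo-mono (ℕ.≤⇒≤′ k≥N)))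

    cauchy-lo : Cauchy (λ k → lo (bracket k))
    cauchy-lo ε ε>0 = proj₁ small , λ m k m≥N k≥N →
      ∣∣-≤ (lo (bracket m) ℚ.- lo (bracket k))
        (ℚ.≤-trans (lo-close (proj₁ small) m k m≥N k≥N) (proj₂ small))
        (subst (ℚ._≤ ε)
          (solve 2 (λ p q → q :- p := :- (p :- q)) refl (lo (bracket m)) (lo (bracket k)))
          (ℚ.≤-trans (lo-close (proj₁ small) k m k≥N m≥N) (proj₂ small)))
      where small = width-small ε ε>0

    -- The supremum of the q for which A − q I is positive definite.
    μ : ℝ
    μ = mkℝ (λ k → lo (bracket k)) cauchy-lo

    -- The real matrix is tied to A only through its terms, which suits entries that are chosen by
    -- an `if`.
    module _ (A-sym : ℚF.Symmetric A) (Aℝ : Matrix n)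
             (Aℝ≗A : ∀ i j m → seq (Aℝ i j) m ≡ A i j) where

      lo-bound : ∀ k x → lo (bracket k) ℚ.* x ℚF.· x ℚ.≤ ℚF.form A x
      lo-bound k x = 0≤q-p⇒p≤q (subst (0ℚ ℚ.≤_) (ℚF.form--δ A (lo (bracket k)) x)
        (nonneg⇒0≤ {ℚF.form (A -δ lo (bracket k)) x} (ℚF.form-nonneg (A -δ lo (bracket k))
          (ℚF.-δ-symmetric {M = A} (lo (bracket k)) A-sym) (pd-lo (bracket k)) x)))

      seq-form-Aℝ : ∀ v m → seq (ℝF.form Aℝ v) m ≡ ℚF.form A (λ i → seq (v i) m)
      seq-form-Aℝ v m = trans (seq-form Aℝ v m)
        (ℚF.form-cong {v = λ i → seq (v i) m} (λ i j → Aℝ≗A i j m) (λ _ → refl))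

      -- The m-th term of the difference involves only the rational vector of m-th terms of v and
      -- `lo (bracket m)`, so `lo-bound` applies at every index.
      μ-bound : ∀ v → ℝF.Nonneg (ℝF.form Aℝ v -ℝ μ *ℝ v ℝF.· v)
      μ-bound v = nonnegℝ (ℝF.form Aℝ v -ℝ μ *ℝ v ℝF.· v) 0 λ m _ →
        subst₂ (λ p q → 0ℚ ℚ.≤ p ℚ.- lo (bracket m) ℚ.* q)
          (sym (seq-form-Aℝ v m)) (sym (seq-· v v m))
          (p≤q⇒0≤q-p (lo-bound m (λ i → seq (v i) m)))

      Aℝ-sym : ℝF.Symmetric Aℝ
      Aℝ-sym i j = ≗⇒≈ {Aℝ i j} {Aℝ j i} λ m →
        trans (Aℝ≗A i j m) (trans (A-sym i j) (sym (Aℝ≗A j i m)))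

      ¬¬isotropic : ∀ k → ¬ ¬ (∃[ w ] (0ℚ ℚ.< w ℚF.· w ×
        ℚF.form A w ℚ.≤ hi (bracket k) ℚ.* w ℚF.· w))
      ¬¬isotropic k c = ℚF.¬posDef⇒nonpositive (A -δ h)
        (ℚF.-δ-symmetric {M = A} h A-sym) (¬pd-hi (bracket k))
        λ (w , w·w>0 , nw) → c (w , w·w>0 , 0≤q-p⇒p≤q (subst (0ℚ ℚ.≤_)
          (trans (cong ℚ.-_ (ℚF.form--δ A h w))
            (solve 2 (λ f t → :- (f :- t) := t :- f) refl (ℚF.form A w) (h ℚ.* w ℚF.· w)))
          (nonneg⇒0≤ {ℚ.- ℚF.form (A -δ h) w} nw)))
        where h = hi (bracket k)

      -- For m ≥ k the lower ends have only increased, so hi k = lo k + width k ≤ lo m + width k.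
      -- Thus a vector with quotient at most hi k has quotient at most μ + width k.
      μ-attained : ∀ k w → ℚF.form A w ℚ.≤ hi (bracket k) ℚ.* w ℚF.· w → 
        let v = λ i → fromℚ (w i) in
        ℝF.Nonneg ((μ +ℝ fromℚ (width (bracket k))) *ℝ v ℝF.· v -ℝ ℝF.form Aℝ v)
      μ-attained k w form≤ =
        nonnegℝ ((μ +ℝ fromℚ (width (bracket k))) *ℝ v ℝF.· v -ℝ ℝF.form Aℝ v) k λ m m≥k →
          subst₂ (λ p q → 0ℚ ℚ.≤ (lo (bracket m) ℚ.+ width (bracket k)) ℚ.* p ℚ.- q)
            (sym (seq-· v v m)) (sym (seq-form-Aℝ v m))
            (p≤q⇒0≤q-p (ℚ.≤-trans form≤ (ℚ.*-monoʳ-≤-nonNeg (w ℚF.· w)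
              {{ℚ.nonNegative (nonneg⇒0≤ {w ℚF.· w} (ℚF.nonneg-norm w))}} (begin
                hi (bracket k)
                  ≡⟨ solve 2 (λ l h → h := l :+ (h :- l)) refl (lo (bracket k)) (hi (bracket k)) ⟩
                lo (bracket k) ℚ.+ width (bracket k)
                  ≤⟨ ℚ.+-monoˡ-≤ (width (bracket k)) (lo-mono (ℕ.≤⇒≤′ m≥k)) ⟩
                lo (bracket m) ℚ.+ width (bracket k) ∎))))
        where v = λ i → fromℚ (w i)

      width-gap : ∀ e D → Posℝ e → ∃[ k ] Posℝ (e -ℝ D *ℝ fromℚ (width (bracket k)))
      width-gap e D pe@(ε , ε>0 , _) =
        let b , b>0 , N , D≤b = bounded (cauchy D)
            η , η>0 , bη≡½ε = shrink b b>0 (½ ℚ.* ε) (½*pos ε>0)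
            k , w≤η = width-small η η>0
        in k , pos-gap e D (width (bracket k)) b N pe D≤b (p≤q⇒0≤q-p (lo≤hi (bracket k)))
          (ℚ.≤-trans (ℚ.*-monoˡ-≤-nonNeg b {{ℚ.nonNegative (ℚ.<⇒≤ b>0)}} w≤η)
            (ℚ.≤-reflexive bη≡½ε))

      -- μ is a lower bound by `μ-bound`. It is the greatest one because a bracket of width η with D
      -- η < e contains the upper end, where a rational direction w has quotient at most μ + η.
      ¬¬eigenvalue : ¬ ¬ IsEigenvalue Aℝ μ
      ¬¬eigenvalue k = ℝF.infimum⇒¬¬kernel {M = Aℝ} {μ} Aℝ-sym μ-bound
        (λ e D pe _ c → let k , gap = width-gap e D pe in
          ¬¬isotropic k λ (w , w·w>0 , form≤) → let v = λ i → fromℚ (w i) in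
            c (fromℚ (width (bracket k)) , v , gap ,
              (w ℚF.· w , w·w>0 , 0 , λ m _ → ℚ.≤-reflexive (sym (seq-· v v m))) ,
              μ-attained k w form≤))
        (λ ker → k (ℝF.kernel--δ⇒eigenvector {M = Aℝ} {μ} ker))

-- With upper end |a| the first pivot a - |a| is not positive; taking |a| instead of a also puts the
-- upper end above -q. The double negation at the lower end is removed by decidability.
initialBracket : ∀ {n} .{{_ : ℕ.NonZero n}} (A : ℚF.SquareMatrix n) → ℚF.Symmetric A → Bracket A
initialBracket {suc n} A A-sym = record
  { lo     = ℚ.- q
  ; hi     = ℚ.∣ a ∣
  ; lo≤hi  = ℚ.≤-trans (ℚ.neg-antimono-≤ (nonneg⇒0≤ {q} (proj₁ (proj₂ shift)))) (ℚ.0≤∣p∣ a)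
  ; pd-lo  = decidable-stable (posDef? (A ℚF.-δ (ℚ.- q))) (proj₂ (proj₂ shift))
  ; ¬pd-hi = λ (a-∣a∣>0 , _) → ℚ.<-irrefl refl (ℚ.<-≤-trans a-∣a∣>0 (begin
      a ℚ.+ (ℚ.- ℚ.∣ a ∣) ℚ.* 1ℚ  ≡⟨ cong (a ℚ.+_) (ℚ.*-identityʳ (ℚ.- ℚ.∣ a ∣)) ⟩
      a ℚ.- ℚ.∣ a ∣               ≤⟨ ℚ.+-monoˡ-≤ (ℚ.- ℚ.∣ a ∣) (p≤∣p∣ a) ⟩
      ℚ.∣ a ∣ ℚ.- ℚ.∣ a ∣           ≡⟨ ℚ.+-inverseʳ ℚ.∣ a ∣ ⟩
      0ℚ                        ∎))
  }
  where
  open ℚ.≤-Reasoning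
  a = ℚF.corner A
  shift = ℚF.shift⇒¬¬posDef A A-sym
  q = proj₁ shift

-- The goal is a negation, so μ may be taken to be an eigenvalue; then τ ≤ μ, and the bound for μ
-- passes to τ.
smallestEigenvalue-bound : ∀ {n} .{{_ : ℕ.NonZero n}} (A : ℚF.SquareMatrix n) → ℚF.Symmetric A →
  (Aℝ : Matrix n) → (∀ i j m → seq (Aℝ i j) m ≡ A i j) →
  ∀ τ → IsSmallestEigenvalue Aℝ τ → ∀ v → ℝF.Nonneg (ℝF.form Aℝ v -ℝ τ *ℝ v ℝF.· v)
smallestEigenvalue-bound A A-sym Aℝ Aℝ≗A τ (_ , least) v neg =
  ¬¬eigenvalue A-sym Aℝ Aℝ≗A λ eigen →
    ℝF.nonneg-bound-antitone {ℝF.form Aℝ v} {v ℝF.· v} {τ} {μ}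
      (ℝF.nonneg-norm v) (≤ℝ⇒nonnegℝ {τ} {μ} (least μ eigen)) (μ-bound A-sym Aℝ Aℝ≗A v) neg
  where open Bisection A (initialBracket A A-sym)

open ℚF using (sum; sum-cong-≋; ∑-distrib-+; ∑-comm; _·_; form)

-- Counting induced edges

𝟙 : Bool → ℚ
𝟙 b = if b then 1ℚ else 0ℚ

𝟙-∧ : ∀ a b → 𝟙 (a ∧ b) ≡ 𝟙 a ℚ.* 𝟙 b
𝟙-∧ true  b = sym (ℚ.*-identityˡ (𝟙 b))
𝟙-∧ false b = sym (ℚ.*-zeroˡ (𝟙 b))

𝟙-idem : ∀ b → 𝟙 b ℚ.* 𝟙 b ≡ 𝟙 b
𝟙-idem true  = refl
𝟙-idem false = refl

χ : ∀ {n} → Subset n → Vector ℚ n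
χ S i = 𝟙 (does (i ∈? S))

sum-χ : ∀ {n} (S : Subset n) → sum (χ S) ≡ ι (∣ S ∣)
sum-χ []            = refl
sum-χ (inside ∷ S)  = trans (cong (1ℚ ℚ.+_) (sum-χ S)) (sym (ι-+ 1 (∣ S ∣)))
sum-χ (outside ∷ S) = trans (ℚ.+-identityˡ _) (sum-χ S)

∈?-tabulate : ∀ {n} (f : Fin n → Bool) i → does (i ∈? Vec.tabulate f) ≡ f i
∈?-tabulate f zero with f zero
... | true  = refl
... | false = refl
∈?-tabulate f (suc i) = ∈?-tabulate (f ∘ suc) i

-- Sums over lists and over pairs of vertices

module _ {X : Set} where
  sumList : (X → ℚ) → List X → ℚ
  sumList f []       = 0ℚ
  sumList f (x ∷ xs) = f x ℚ.+ sumList f xs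

  sumList-++ : ∀ f xs ys → sumList f (xs List.++ ys) ≡ sumList f xs ℚ.+ sumList f ys
  sumList-++ f []       ys = sym (ℚ.+-identityˡ _)
  sumList-++ f (x ∷ xs) ys = trans (cong (f x ℚ.+_) (sumList-++ f xs ys))
    (sym (ℚ.+-assoc (f x) (sumList f xs) (sumList f ys)))

  -- This turns the nested filters that define `inducedEdges` into products of indicators.
  sumList-filter : ∀ {P : Pred X 0ℓ} (P? : Decidable P) f xs →
    sumList f (filter P? xs) ≡ sumList (λ x → 𝟙 (does (P? x)) ℚ.* f x) xs
  sumList-filter P? f [] = refl
  sumList-filter P? f (x ∷ xs) with does (P? x)
  ... | true  = cong₂ ℚ._+_ (sym (ℚ.*-identityˡ (f x))) (sumList-filter P? f xs)
  ... | false = trans (sumList-filter P? f xs)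
    (trans (sym (ℚ.+-identityˡ _)) (cong (ℚ._+ _) (sym (ℚ.*-zeroˡ (f x)))))

  sumList-1 : ∀ xs → sumList (λ _ → 1ℚ) xs ≡ ι (length xs)
  sumList-1 []       = refl
  sumList-1 (x ∷ xs) = trans (cong (1ℚ ℚ.+_) (sumList-1 xs)) (sym (ι-+ 1 (length xs)))

  sumList-tabulate : ∀ {n} f (g : Fin n → X) → sumList f (List.tabulate g) ≡ sum (f ∘ g)
  sumList-tabulate {zero}  f g = refl
  sumList-tabulate {suc n} f g = cong (f (g zero) ℚ.+_) (sumList-tabulate f (g ∘ suc))

sumList-map : ∀ {X Y : Set} f (g : X → Y) xs → sumList f (List.map g xs) ≡ sumList (f ∘ g) xs
sumList-map f g []       = refl
sumList-map f g (x ∷ xs) = cong (f (g x) ℚ.+_) (sumList-map f g xs)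

sumList-cartesianProduct : ∀ {X Y : Set} f (xs : List X) (ys : List Y) →
  sumList f (cartesianProduct xs ys) ≡ sumList (λ x → sumList (λ y → f (x , y)) ys) xs
sumList-cartesianProduct f []       ys = refl
sumList-cartesianProduct f (x ∷ xs) ys = trans (sumList-++ f (List.map (x ,_) ys) _)
  (cong₂ ℚ._+_ (sumList-map f (x ,_) ys) (sumList-cartesianProduct f xs ys))

sumList-pairs : ∀ {n} (f : Fin n × Fin n → ℚ) →
  sumList f (cartesianProduct (allFin n) (allFin n)) ≡ sum (λ i → sum (λ j → f (i , j)))
sumList-pairs {n} f = trans (sumList-cartesianProduct f (allFin n) (allFin n))
  (trans (sumList-tabulate (λ i → sumList (λ j → f (i , j)) (allFin n)) id)
    (sum-cong-≋ (λ i → sumList-tabulate (λ j → f (i , j)) id)))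

-- The indices are exchanged in one copy of the half sum. Off the diagonal exactly one of i < j and
-- j < i holds, and on the diagonal f is 0.
sum-pairs-< : ∀ {n} (f : Fin n → Fin n → ℚ) → (∀ i j → f i j ≡ f j i) → (∀ i → f i i ≡ 0ℚ) →
  let half = sum (λ i → sum (λ j → 𝟙 (does (i <? j)) ℚ.* f i j)) in
  half ℚ.+ half ≡ sum (λ i → sum (f i))
sum-pairs-< {n} f f-sym f-diag = begin
  ∑∑ g ℚ.+ ∑∑ g
    ≡⟨ cong (∑∑ g ℚ.+_) (∑-comm g) ⟩
  ∑∑ g ℚ.+ ∑∑ (λ i j → g j i)
    ≡⟨ ∑-distrib-+ (λ i → sum (g i)) (λ i → sum (λ j → g j i)) ⟨
  sum (λ i → sum (g i) ℚ.+ sum (λ j → g j i))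
    ≡⟨ sum-cong-≋ (λ i → trans (sym (∑-distrib-+ (g i) (λ j → g j i))) (sum-cong-≋ (pointwise i))) ⟩
  ∑∑ f ∎
  where
  open ≡-Reasoning
  g : Fin n → Fin n → ℚ
  g i j = 𝟙 (does (i <? j)) ℚ.* f i j
  ∑∑ : (Fin n → Fin n → ℚ) → ℚ
  ∑∑ h = sum (λ i → sum (h i))
  1*+0* : ∀ p q → 1ℚ ℚ.* p ℚ.+ 0ℚ ℚ.* q ≡ p
  1*+0* p q = trans (cong₂ ℚ._+_ (ℚ.*-identityˡ p) (ℚ.*-zeroˡ q)) (ℚ.+-identityʳ p)
  pointwise : ∀ i j → g i j ℚ.+ g j i ≡ f i j
  pointwise i j with <-cmp i j
  ... | tri< i<j _ j≮i rewrite dec-true (i <? j) i<j | dec-false (j <? i) j≮i =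
    1*+0* (f i j) (f j i)
  ... | tri> i≮j _ j<i rewrite dec-true (j <? i) j<i | dec-false (i <? j) i≮j =
    trans (ℚ.+-comm (0ℚ ℚ.* f i j) _) (trans (1*+0* (f j i) (f i j)) (f-sym j i))
  ... | tri≈ i≮i refl _ rewrite dec-false (i <? i) i≮i | f-diag i = refl

-- The adjacency form of a graph

module _ {n} (G : Graph n) where
  open Graph G

  adjacency : ℚF.SquareMatrix n
  adjacency i j = 𝟙 (does (i ~? j))

  adjacencyMatrix-seq : ∀ i j m → seq (adjacencyMatrix G i j) m ≡ adjacency i j
  adjacencyMatrix-seq i j m with does (i ~? j)
  ... | true  = refl
  ... | false = refl

  adjacency-symmetric : ℚF.Symmetric adjacency
  adjacency-symmetric i j with i ~? j | j ~? i
  ... | yes _   | yes _   = refl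
  ... | no _    | no _    = refl
  ... | yes i~j | no j≁i  = contradiction (~-sym i~j) j≁i
  ... | no i≁j  | yes j~i = contradiction (~-sym j~i) i≁j

  adjacency-diagonal : ∀ i → adjacency i i ≡ 0ℚ
  adjacency-diagonal i = cong 𝟙 (dec-false (i ~? i) (~-irrefl refl))

  adjacency-row-sum : ∀ {k} → Regular G k → ∀ i → sum (adjacency i) ≡ ι k
  adjacency-row-sum reg i = trans
    (sum-cong-≋ (λ j → cong 𝟙 (sym (∈?-tabulate (λ j → does (i ~? j)) j))))
    (trans (sum-χ (neighbours G i)) (cong ι (reg i)))

  -- An edge inside S is listed once, with its smaller endpoint first, but contributes to the form
  -- at (i , j) and at (j , i).
  ℰ-form : ∀ S → ι (ℰ G S) ℚ.+ ι (ℰ G S) ≡ form adjacency (χ S)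
  ℰ-form S = begin
    ι (ℰ G S) ℚ.+ ι (ℰ G S)
      ≡⟨ cong (λ q → q ℚ.+ q) (begin
        ι (length (inducedEdges G S))
          ≡⟨ sumList-1 (inducedEdges G S) ⟨
        sumList (λ _ → 1ℚ) (inducedEdges G S)
          ≡⟨ sumList-filter (bothIn? G S) (λ _ → 1ℚ) (edges G) ⟩
        sumList b (edges G)
          ≡⟨ sumList-filter (isEdge? G) b (cartesianProduct (allFin n) (allFin n)) ⟩
        sumList (λ p → 𝟙 (does (isEdge? G p)) ℚ.* b p) (cartesianProduct (allFin n) (allFin n))
          ≡⟨ sumList-pairs (λ p → 𝟙 (does (isEdge? G p)) ℚ.* b p) ⟩
        sum (λ i → sum (λ j →
          𝟙 (does (i <? j) ∧ does (i ~? j)) ℚ.* (𝟙 (does (i ∈? S) ∧ does (j ∈? S)) ℚ.* 1ℚ)))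
          ≡⟨ sum-cong-≋ (λ i → sum-cong-≋ (λ j → weight i j)) ⟩
        sum (λ i → sum (λ j → 𝟙 (does (i <? j)) ℚ.* f i j)) ∎) ⟩
    _ ≡⟨ sum-pairs-< f
           (λ i j → trans (cong (λ a → χ S i ℚ.* (a ℚ.* χ S j)) (adjacency-symmetric i j))
             (solve 3 (λ x a y → x :* (a :* y) := y :* (a :* x)) refl (χ S i) (adjacency j i) (χ S j)))
           (λ i → trans (cong (λ a → χ S i ℚ.* (a ℚ.* χ S i)) (adjacency-diagonal i))
             (solve 1 (λ x → x :* (con 0ℚ :* x) := con 0ℚ) refl (χ S i))) ⟩
    sum (λ i → sum (f i))
      ≡⟨ sum-cong-≋ (λ i → sym (ℚF.*-distribˡ-sum (χ S i) (λ j → adjacency i j ℚ.* χ S j))) ⟩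
    form adjacency (χ S) ∎
    where
    open ≡-Reasoning
    open +-*-Solver
    b : Fin n × Fin n → ℚ
    b p = 𝟙 (does (bothIn? G S p)) ℚ.* 1ℚ
    f : Fin n → Fin n → ℚ
    f i j = χ S i ℚ.* (adjacency i j ℚ.* χ S j)
    weight : ∀ i j →
      𝟙 (does (i <? j) ∧ does (i ~? j)) ℚ.* (𝟙 (does (i ∈? S) ∧ does (j ∈? S)) ℚ.* 1ℚ)
        ≡ 𝟙 (does (i <? j)) ℚ.* f i j
    weight i j = trans
      (cong₂ (λ p q → p ℚ.* (q ℚ.* 1ℚ)) (𝟙-∧ (does (i <? j)) (does (i ~? j)))
        (𝟙-∧ (does (i ∈? S)) (does (j ∈? S))))
      (solve 4 (λ l a x y → (l :* a) :* ((x :* y) :* con 1ℚ) := l :* (x :* (a :* y))) refl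
        (𝟙 (does (i <? j))) (adjacency i j) (χ S i) (χ S j))

-- The Rayleigh inequality at the centred indicator vector

open import Data.Integer.Base using (+_)
open import Data.Nat.Base using (_*_; _^_)
open import Data.Nat.Properties using (m*n≢0)
open import Data.Rational.Base using (_/_)

-- The quotient is reduced by a gcd, so the cancellation is checked by cross multiplication of
-- unnormalised representatives.
/-*-cancel : ∀ a b .{{_ : NonZero b}} → (+ a / b) ℚ.* ι b ≡ ι a
/-*-cancel a (suc b) = ℚ.toℚᵘ-injective (begin
  ℚ.toℚᵘ ((+ a / suc b) ℚ.* ι (suc b))
    ≈⟨ ℚ.toℚᵘ-homo-* (+ a / suc b) (ι (suc b)) ⟩
  ℚ.toℚᵘ (+ a / suc b) ℚᵘ.* ℚ.toℚᵘ (ι (suc b))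
    ≈⟨ ℚᵘ.*-cong (ℚ.toℚᵘ-fromℚᵘ (ℚᵘ.mkℚᵘ (+ a) b)) (ℚᵘ.≃-reflexive (toℚᵘ-ι (suc b))) ⟩
  ℚᵘ.mkℚᵘ (+ a) b ℚᵘ.* ℚᵘ.mkℚᵘ (+ suc b) 0
    ≈⟨ ℚᵘ.*≡* (trans (ℤ.*-identityʳ _) (cong (λ d → + a ℤ.* + d) (sym (ℕ.*-identityʳ (suc b))))) ⟩
  ℚᵘ.mkℚᵘ (+ a) 0
    ≡⟨ toℚᵘ-ι a ⟨
  ℚ.toℚᵘ (ι a) ∎)
  where
  open ℚᵘ.≃-Reasoning

sum-1 : ∀ n → ℚF.sum {n} (λ _ → 1ℚ) ≡ ι n
sum-1 zero    = refl
sum-1 (suc n) = trans (cong (1ℚ ℚ.+_) (sum-1 n)) (sym (ι-+ 1 n))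

-- n 1_S − |S| 1, a multiple of the projection of 1_S to the orthogonal
-- complement of the eigenvector 1 of a regular graph.
centred : ∀ {n} → Subset n → Vector ℚ n
centred {n} S i = ι n ℚ.* χ S i ℚ.+ (ℚ.- ι ∣ S ∣) ℚ.* 1ℚ

module _ {n k : ℕ} (G : Graph n) (reg : Regular G k) (S : Subset n) where
  open ℚF using (_·_; form)
  open ≡-Reasoning

  private
    A = adjacency G
    c = χ S
    N = ι n
    s = ι ∣ S ∣
    E = ι (ℰ G S)
    x = centred S
    one : Vector ℚ n
    one _ = 1ℚ

  private
    ·one : ∀ (v : Vector ℚ n) → v · one ≡ ℚF.sum v
    ·one v = ℚF.sum-cong-≋ (λ i → ℚ.*-identityʳ (v i))

    c·one : c · one ≡ s
    c·one = trans (·one c) (sum-χ S)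

    c·c : c · c ≡ s
    c·c = trans (ℚF.sum-cong-≋ (λ i → 𝟙-idem (does (i ∈? S)))) (sum-χ S)

    -- Orthogonality to the eigenvector 1 removes one of the two terms when the second factor x in
    -- x·x or in x·Ax is expanded.
    x·one : x · one ≡ 0ℚ
    x·one = begin
      x · one
        ≡⟨ ℚF.·-linearˡ c one one N (ℚ.- s) ⟩
      N ℚ.* c · one ℚ.+ (ℚ.- s) ℚ.* one · one
        ≡⟨ cong₂ (λ p q → N ℚ.* p ℚ.+ (ℚ.- s) ℚ.* q) c·one (trans (·one one) (sum-1 n)) ⟩
      N ℚ.* s ℚ.+ (ℚ.- s) ℚ.* N
        ≡⟨ solve 2 (λ N s → N :* s :+ :- s :* N := con 0ℚ) refl N s ⟩
      0ℚ ∎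
      where open +-*-Solver

    A·one : ∀ i → A i · one ≡ ι k
    A·one i = trans (·one (A i)) (adjacency-row-sum G reg i)

    -- By symmetry A can act on 1 instead, which it multiplies by k.
    one·Ac : one · (λ i → A i · c) ≡ ι k ℚ.* s
    one·Ac = begin
      one · (λ i → A i · c)    ≡⟨ ℚF.form-symmetric {M = A} (adjacency-symmetric G) one c ⟩
      c · (λ i → A i · one)    ≡⟨ ℚF.·-cong {u = c} (λ _ → refl)
                                    (λ i → trans (A·one i) (sym (ℚ.*-identityʳ (ι k)))) ⟩
      c · (λ i → ι k ℚ.* one i) ≡⟨ ℚF.·-scaleʳ c one (ι k) ⟩
      ι k ℚ.* c · one          ≡⟨ cong (ι k ℚ.*_) c·one ⟩
      ι k ℚ.* s                ∎

  centred-norm : x · x ≡ N ℚ.* (N ℚ.* s ℚ.- s ℚ.* s)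
  centred-norm = begin
    x · x
      ≡⟨ ℚF.·-linearʳ x c one N (ℚ.- s) ⟩
    N ℚ.* x · c ℚ.+ (ℚ.- s) ℚ.* x · one
      ≡⟨ cong₂ (λ p q → N ℚ.* p ℚ.+ (ℚ.- s) ℚ.* q) (ℚF.·-linearˡ c one c N (ℚ.- s)) x·one ⟩
    N ℚ.* (N ℚ.* c · c ℚ.+ (ℚ.- s) ℚ.* one · c) ℚ.+ (ℚ.- s) ℚ.* 0ℚ
      ≡⟨ cong₂ (λ p q → N ℚ.* (N ℚ.* p ℚ.+ (ℚ.- s) ℚ.* q) ℚ.+ (ℚ.- s) ℚ.* 0ℚ) c·c
           (trans (ℚF.·-comm one c) c·one) ⟩
    N ℚ.* (N ℚ.* s ℚ.+ (ℚ.- s) ℚ.* s) ℚ.+ (ℚ.- s) ℚ.* 0ℚ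
      ≡⟨ solve 2 (λ N s → N :* (N :* s :+ :- s :* s) :+ :- s :* con 0ℚ := N :* (N :* s :- s :* s))
           refl N s ⟩
    N ℚ.* (N ℚ.* s ℚ.- s ℚ.* s) ∎
    where open +-*-Solver

  centred-form : form A x ≡ N ℚ.* (N ℚ.* (E ℚ.+ E) ℚ.- s ℚ.* (ι k ℚ.* s))
  centred-form = begin
    form A x
      ≡⟨ ℚF.·-cong {u = x} (λ _ → refl) (λ i → trans (ℚF.·-linearʳ (A i) c one N (ℚ.- s))
           (cong (N ℚ.* A i · c ℚ.+_) (trans (cong ((ℚ.- s) ℚ.*_) (A·one i)) (sym (ℚ.*-identityʳ _))))) ⟩
    x · (λ i → N ℚ.* A i · c ℚ.+ ((ℚ.- s) ℚ.* ι k) ℚ.* one i)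
      ≡⟨ ℚF.·-linearʳ x (λ i → A i · c) one N ((ℚ.- s) ℚ.* ι k) ⟩
    N ℚ.* x · (λ i → A i · c) ℚ.+ ((ℚ.- s) ℚ.* ι k) ℚ.* x · one
      ≡⟨ cong₂ (λ p q → N ℚ.* p ℚ.+ ((ℚ.- s) ℚ.* ι k) ℚ.* q)
           (ℚF.·-linearˡ c one (λ i → A i · c) N (ℚ.- s)) x·one ⟩
    N ℚ.* (N ℚ.* form A c ℚ.+ (ℚ.- s) ℚ.* one · (λ i → A i · c)) ℚ.+ ((ℚ.- s) ℚ.* ι k) ℚ.* 0ℚ
      ≡⟨ cong₂ (λ p q → N ℚ.* (N ℚ.* p ℚ.+ (ℚ.- s) ℚ.* q) ℚ.+ ((ℚ.- s) ℚ.* ι k) ℚ.* 0ℚ)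
           (sym (ℰ-form G S)) one·Ac ⟩
    N ℚ.* (N ℚ.* (E ℚ.+ E) ℚ.+ (ℚ.- s) ℚ.* (ι k ℚ.* s)) ℚ.+ ((ℚ.- s) ℚ.* ι k) ℚ.* 0ℚ
      ≡⟨ solve 4 (λ N E s k → N :* (N :* (E :+ E) :+ :- s :* (k :* s)) :+ (:- s :* k) :* con 0ℚ
           := N :* (N :* (E :+ E) :- s :* (k :* s))) refl N E s (ι k) ⟩
    N ℚ.* (N ℚ.* (E ℚ.+ E) ℚ.- s ℚ.* (ι k ℚ.* s)) ∎
    where open +-*-Solver

  -- The parameter t is rational because the identity is applied to each term of the sequence of τ.
  centred-gap : .{{_ : NonZero n}} → ∀ t →
    let q = _/_ (+ (∣ S ∣ ^ 2)) (2 * n) {{m*n≢0 2 n}} in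
    form A x ℚ.- t ℚ.* x · x
      ≡ ((N ℚ.+ N) ℚ.* N) ℚ.* (E ℚ.- (q ℚ.* (ι k ℚ.- t) ℚ.+ s ℚ.* t ℚ.* ½))
  centred-gap t = begin
    form A x ℚ.- t ℚ.* x · x
      ≡⟨ cong₂ (λ f w → f ℚ.- t ℚ.* w) centred-form centred-norm ⟩
    N ℚ.* (N ℚ.* (E ℚ.+ E) ℚ.- s ℚ.* (ι k ℚ.* s)) ℚ.- t ℚ.* (N ℚ.* (N ℚ.* s ℚ.- s ℚ.* s))
      ≡⟨ solve 5 (λ N E s k t →
           N :* (N :* (E :+ E) :- s :* (k :* s)) :- t :* (N :* (N :* s :- s :* s))
             := (N :+ N) :* N :* (E :- s :* t :* con ½) :- (s :* s) :* N :* (k :- t))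
           refl N E s (ι k) t ⟩
    (N ℚ.+ N) ℚ.* N ℚ.* (E ℚ.- s ℚ.* t ℚ.* ½) ℚ.- (s ℚ.* s) ℚ.* N ℚ.* (ι k ℚ.- t)
      -- Writing |S|² as q · 2n here lets `q` be an unknown in the polynomial identity that follows;
      -- the division enters only through `q*2N`.
      ≡⟨ cong (λ p → (N ℚ.+ N) ℚ.* N ℚ.* (E ℚ.- s ℚ.* t ℚ.* ½) ℚ.- p ℚ.* N ℚ.* (ι k ℚ.- t)) q*2N ⟨
    (N ℚ.+ N) ℚ.* N ℚ.* (E ℚ.- s ℚ.* t ℚ.* ½) ℚ.- (q ℚ.* (N ℚ.+ N)) ℚ.* N ℚ.* (ι k ℚ.- t)
      ≡⟨ solve 6 (λ N E s k t q →
           (N :+ N) :* N :* (E :- s :* t :* con ½) :- (q :* (N :+ N)) :* N :* (k :- t)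
             := ((N :+ N) :* N) :* (E :- (q :* (k :- t) :+ s :* t :* con ½)))
           refl N E s (ι k) t q ⟩
    ((N ℚ.+ N) ℚ.* N) ℚ.* (E ℚ.- (q ℚ.* (ι k ℚ.- t) ℚ.+ s ℚ.* t ℚ.* ½)) ∎
    where
    open +-*-Solver
    instance _ = m*n≢0 2 n
    q = + (∣ S ∣ ^ 2) / (2 * n)
    q*2N : q ℚ.* (N ℚ.+ N) ≡ s ℚ.* s
    q*2N = begin
      q ℚ.* (N ℚ.+ N)         ≡⟨ cong (q ℚ.*_) (solve 1 (λ N → N :+ N := (con 1ℚ :+ con 1ℚ) :* N) refl N) ⟩
      q ℚ.* (ι 2 ℚ.* N)       ≡⟨ cong (q ℚ.*_) (ι-* 2 n) ⟨
      q ℚ.* ι (2 * n)         ≡⟨ /-*-cancel (∣ S ∣ ^ 2) (2 * n) ⟩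
      ι (∣ S ∣ ^ 2)           ≡⟨ ι-* ∣ S ∣ (∣ S ∣ * 1) ⟩
      s ℚ.* ι (∣ S ∣ * 1)     ≡⟨ cong (s ℚ.*_) (trans (ι-* ∣ S ∣ 1) (ℚ.*-identityʳ s)) ⟩
      s ℚ.* s                 ∎

proposition1p6 : ∀ {n k : ℕ} .{{_ : NonZero n}} (G : Graph n) → Regular G k →
    (τ : ℝ) → IsSmallestEigenvalue (adjacencyMatrix G) τ →
    (S : Subset n) →
    fromℚ (_/_ (+ (∣ S ∣ ^ 2)) (2 * n) {{m*n≢0 2 n}}) *ℝ (fromℕ k -ℝ τ)
    +ℝ fromℕ ∣ S ∣ *ℝ τ *ℝ fromℚ ½
    ≤ℝ fromℕ (ℰ G S)
proposition1p6 {n} {k} G reg τ least S =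
  nonnegℝ⇒≤ℝ {lower} {fromℕ (ℰ G S)}
    -- The Rayleigh inequality at `v` is 2n² times the required one: `gap` proves this at every
    -- index, and the positive factor is then cancelled.
    (ℝF.nonneg-cancel {fromℚ 2n²} {fromℕ (ℰ G S) -ℝ lower} 2n²-pos
      (ℝF.nonneg-resp {ℝF.form Aℝ v -ℝ τ *ℝ v ℝF.· v} {fromℚ 2n² *ℝ (fromℕ (ℰ G S) -ℝ lower)}
        (≗⇒≈ {ℝF.form Aℝ v -ℝ τ *ℝ v ℝF.· v} {fromℚ 2n² *ℝ (fromℕ (ℰ G S) -ℝ lower)} gap)
        (smallestEigenvalue-bound (adjacency G) (adjacency-symmetric G) Aℝ
          (adjacencyMatrix-seq G) τ least v)))
  where
  Aℝ = adjacencyMatrix G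
  v = λ i → fromℚ (centred S i)
  2n² = (ι n ℚ.+ ι n) ℚ.* ι n
  lower = fromℚ (_/_ (+ (∣ S ∣ ^ 2)) (2 * n) {{m*n≢0 2 n}}) *ℝ (fromℕ k -ℝ τ)
    +ℝ fromℕ ∣ S ∣ *ℝ τ *ℝ fromℚ ½
  2n²-pos : Posℝ (fromℚ 2n²)
  2n²-pos = 2n² , OrderedAlgebra.pos-* rationals (ℚ.+-mono-< (ι-pos n) (ι-pos n)) (ι-pos n) ,
    0 , λ _ _ → ℚ.≤-refl
  gap : ∀ m → seq (ℝF.form Aℝ v -ℝ τ *ℝ v ℝF.· v) m ≡ seq (fromℚ 2n² *ℝ (fromℕ (ℰ G S) -ℝ lower)) m
  gap m = trans
    (cong₂ (λ f w → f ℚ.- seq τ m ℚ.* w)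
      (trans (seq-form Aℝ v m)
        (ℚF.form-cong {v = λ i → seq (v i) m} (λ i j → adjacencyMatrix-seq G i j m) (λ _ → refl)))
      (seq-· v v m))
    (centred-gap G reg S (seq τ m))
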